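{- Let $k > 6$ be an even integer, let $y \geq 2$ be an integer, let $x$ be a positive integer with $x \neq 2$, and put $u = 4x$ and $g = ky$. Then there exists a $k$-ARCS of $(K_u \times K_g)(2)$.
   Context: For graphs $G,H$, the tensor product $G \times H$ has vertex set $V(G)\times V(H)$, with $(g_1,h_1)$ adjacent to $(g_2,h_2)$ iff $g_1g_2 \in E(G)$ and $h_1h_2 \in E(H)$. For a graph $G$ and positive integer $\lambda$, $G(\lambda)$ is the multigraph obtained by replacing each edge of $G$ by $\lambda$ parallel edges. $K_n$ is the complete graph on $n$ vertices. $(K_u \times K_g)(\lambda)$ is regarded as a $u$-partite multigraph with partite sets $V_i = \{i\}\times V(K_g)$, $i=1,\dots,u$. A partial $C_k$-factor of $(K_u \times K_g)(\lambda)$ is a subgraph which, for some $i$, is a spanning subgraph of $(K_u \times K_g)(\lambda)\setminus V_i$ all of whose components are cycles of length $k$. A $k$-ARCS of $(K_u \times K_g)(\lambda)$ is a partition of its edge multiset into partial $C_k$-factors. -}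

module Defs where

open import Data.Nat using (ℕ; zero; suc; _+_)
import Data.Nat as ℕ
open import Data.Fin using (Fin; zero; suc; toℕ; lower₁)
import Data.Fin as F
open import Data.Product using (_×_; _,_; proj₁; proj₂; Σ)
open import Data.Product.Properties using (≡-dec)
open import Data.List using (List; map; allFin)
open import Data.Nat.ListAction using (sum)
open import Function.Definitions using (Injective)
open import Relation.Binary.PropositionalEquality using (_≡_; _≢_)
open import Relation.Nullary using (yes; no; _⊎-dec_; _×-dec_)
open import Relation.Nullary.Decidable using (⌊_⌋; Dec)
open import Data.Bool using (Bool; true; false; if_then_else_)

-- Vertices of K_u × K_g : pairs (i , j); partite set V_i = {i} × Fin g.
Vtx : ℕ → ℕ → Set
Vtx u g = Fin u × Fin g

Adj : ∀ {u g} → Vtx u g → Vtx u g → Set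
Adj (i₁ , j₁) (i₂ , j₂) = (i₁ ≢ i₂) × (j₁ ≢ j₂)

_≟V_ : ∀ {u g} (a b : Vtx u g) → Dec (a ≡ b)
_≟V_ = ≡-dec F._≟_ F._≟_

cycSuc : ∀ {n} → Fin n → Fin n
cycSuc {suc n} i with n ℕ.≟ toℕ i
... | yes _ = zero
... | no p  = suc (lower₁ i p)

record Cycle (k u g : ℕ) : Set where
  field
    vert : Fin k → Vtx u g
    inj  : Injective _≡_ _≡_ vert
    adj  : ∀ t → Adj (vert t) (vert (cycSuc t))
open Cycle public

count : ∀ {n} → (Fin n → Bool) → ℕ
count {n} p = sum (map (λ t → if p t then 1 else 0) (allFin n))

vOcc : ∀ {k u g} → Cycle k u g → Vtx u g → ℕ
vOcc c v = count (λ t → ⌊ vert c t ≟V v ⌋)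

eOcc : ∀ {k u g} → Cycle k u g → Vtx u g → Vtx u g → ℕ
eOcc c a b = count (λ t →
  ⌊ ((vert c t ≟V a) ×-dec (vert c (cycSuc t) ≟V b))
    ⊎-dec ((vert c t ≟V b) ×-dec (vert c (cycSuc t) ≟V a)) ⌋)

sumL : ∀ {A : Set} → (A → ℕ) → List A → ℕ
sumL f xs = sum (map f xs)

record PartialFactor (k u g : ℕ) : Set where
  field
    missing : Fin u
    cycles  : List (Cycle k u g)
    cover   : ∀ (v : Vtx u g) →
      (proj₁ v ≡ missing → sumL (λ c → vOcc c v) cycles ≡ 0) ×
      (proj₁ v ≢ missing → sumL (λ c → vOcc c v) cycles ≡ 1)
open PartialFactor public

eOccF : ∀ {k u g} → PartialFactor k u g → Vtx u g → Vtx u g → ℕ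
eOccF F a b = sumL (λ c → eOcc c a b) (cycles F)

-- A k-ARCS of (K_u × K_g)(λ): a list of partial C_k-factors whose cycle
-- edges together use every edge of K_u × K_g exactly λ times (cycle edges
-- are always edges of K_u × K_g, by Cycle.adj).
ARCS : (k u g λ' : ℕ) → Set
ARCS k u g λ' = Σ (List (PartialFactor k u g)) λ Fs →
  ∀ (a b : Vtx u g) → Adj a b → sumL (λ F → eOccF F a b) Fs ≡ λ'

{-# OPTIONS --safe #-}
module Submission where

-- Write k = 2h.  Let Q be an idempotent quasigroup on the u parts and take a C_k-factorization
-- of K_g(2).  Since k is even, each k-cycle of the latter alternates between "sources" and "sinks".
-- For a part v and a factor F of K_g(2), put, for every part i ≠ v, a copy of F with its sources in
-- part i and its sinks in part v ∙ i.  As i ↦ v ∙ i permutes the parts other than v, every vertex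
-- outside part v is used once, as a source or as a sink.  As v ↦ v ∙ i is a bijection, an edge between
-- (i, a) and (j, b) occurs once for each edge a → b of K_g(2) and once for each edge b → a, that is, twice.
--
-- For the factorization of K_g(2), cut the g = 2y · h points into 2y cells of size h and 1-factorize K_{2y}.
-- One of the 1-factors groups the cells into y pairs, on each of which 2h − 1 zigzag Hamiltonian cycles
-- decompose K_{2h}(2).  In the others, each edge is a K_{h,h}(2), which consists of h Hamiltonian cycles.

open import Defs
open import Algebra.Structures using (IsAbelianGroup)
open import Data.Bool using (Bool; true; false; if_then_else_)
import Data.Bool as Bool
open import Data.Empty using (⊥-elim)
open import Data.Fin using (Fin; zero; suc; toℕ; _↑ˡ_; _↑ʳ_; splitAt; join; opposite; cast; fromℕ<; lower₁)
import Data.Fin as F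
open import Data.Fin.Properties using (toℕ<n; toℕ-fromℕ<; toℕ-injective; toℕ-lower₁; toℕ-cast; toℕ-↑ˡ; toℕ-↑ʳ; opposite-prop; opposite-involutive; splitAt-↑ˡ; splitAt-↑ʳ; join-splitAt; cast-involutive; *↔×)
open import Data.Integer using (ℤ; -[1+_]; 0ℤ; 1ℤ) renaming (+_ to ⁺_; _+_ to _+ᶻ_; _*_ to _*ᶻ_; -_ to -ᶻ_)
open import Data.Integer.DivMod using (_/ℕ_; n%ℕd<d; a≡a%ℕn+[a/ℕn]*n)
import Data.Integer.Properties as ℤ
open import Data.Integer.Tactic.RingSolver using () renaming (solve-∀ to solveᶻ-∀)
open import Data.List using (List; []; _∷_; _++_; map; concatMap; allFin; tabulate)
open import Data.List.Properties using (map-tabulate; map-∘; map-++)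
open import Data.Nat using (ℕ; zero; suc; _+_; _*_; _<_; _≤_; s≤s; _∸_)
import Data.Nat as ℕ
open import Data.Nat.Divisibility using (_∣_; divides)
open import Data.Nat.ListAction using () renaming (sum to sumᴸ)
open import Data.Nat.ListAction.Properties using (sum-++)
open import Data.Nat.Properties
open import Data.Nat.Tactic.RingSolver using (solve-∀)
open import Data.Product using (_×_; _,_; proj₁; proj₂)
open import Data.Product.Properties using (≡-dec; ,-injectiveˡ; ,-injectiveʳ)
open import Data.Sum using (_⊎_; inj₁; inj₂)
open import Function using (_∘_; id; _↔_; Inverse; mk↔ₛ′)
open import Function.Properties.Inverse using (↔-trans)
open import Relation.Binary.PropositionalEquality hiding ([_])
open import Relation.Binary.PropositionalEquality.Properties using (isEquivalence)
open import Relation.Nullary using (Dec; yes; no; ¬_; _×-dec_; _⊎-dec_; ¬?)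
open import Relation.Nullary.Decidable using (⌊_⌋)
open import Algebra.Properties.Semiring.Sum +-*-semiring using (∑-distrib-+; sum-cong-≗; *-distribˡ-sum) renaming (sum to ∑)

-- Indicators and finite sums

𝟙 : ∀ {P : Set} → Dec P → ℕ
𝟙 P? = if ⌊ P? ⌋ then 1 else 0

𝟙-yes : ∀ {P : Set} (P? : Dec P) → P → 𝟙 P? ≡ 1
𝟙-yes (yes _) _ = refl
𝟙-yes (no ¬p) p = ⊥-elim (¬p p)

𝟙-no : ∀ {P : Set} (P? : Dec P) → ¬ P → 𝟙 P? ≡ 0
𝟙-no (yes p) ¬p = ⊥-elim (¬p p)
𝟙-no (no _)  _  = refl

𝟙-cong : ∀ {P Q : Set} (P? : Dec P) (Q? : Dec Q) → (P → Q) → (Q → P) → 𝟙 P? ≡ 𝟙 Q?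
𝟙-cong (yes p) Q? f g = sym (𝟙-yes Q? (f p))
𝟙-cong (no ¬p) Q? f g = sym (𝟙-no Q? (¬p ∘ g))

𝟙-× : ∀ {P Q : Set} (P? : Dec P) (Q? : Dec Q) → 𝟙 (P? ×-dec Q?) ≡ 𝟙 P? * 𝟙 Q?
𝟙-× (yes _) (yes _) = refl
𝟙-× (yes _) (no _)  = refl
𝟙-× (no _)  _       = refl

𝟙-⊎ : ∀ {P Q : Set} (P? : Dec P) (Q? : Dec Q) → ¬ (P × Q) → 𝟙 (P? ⊎-dec Q?) ≡ 𝟙 P? + 𝟙 Q?
𝟙-⊎ (yes p) (yes q) ¬pq = ⊥-elim (¬pq (p , q))
𝟙-⊎ (yes _) (no _)  _   = refl
𝟙-⊎ (no _)  (yes _) _   = refl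
𝟙-⊎ (no _)  (no _)  _   = refl

𝟙-absorb : ∀ {P : Set} (P? : Dec P) {m n : ℕ} → (P → m ≡ n) → 𝟙 P? * m ≡ 𝟙 P? * n
𝟙-absorb (yes p) eq = cong (1 *_) (eq p)
𝟙-absorb (no _)  _  = refl

∑-zero : ∀ {n} (f : Fin n → ℕ) → (∀ i → f i ≡ 0) → ∑ f ≡ 0
∑-zero {zero}  f f≡0 = refl
∑-zero {suc n} f f≡0 = cong₂ _+_ (f≡0 zero) (∑-zero (f ∘ suc) (f≡0 ∘ suc))

∑-single : ∀ {n} (f : Fin n → ℕ) i₀ → (∀ i → i ≢ i₀ → f i ≡ 0) → ∑ f ≡ f i₀
∑-single f zero f≡0 =
  trans (cong (f zero +_) (∑-zero (f ∘ suc) (λ i → f≡0 (suc i) λ ()))) (+-identityʳ _)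
∑-single f (suc i₀) f≡0 =
  cong₂ _+_ (f≡0 zero λ ()) (∑-single (f ∘ suc) i₀ (λ i i≢i₀ → f≡0 (suc i) λ { refl → i≢i₀ refl }))

∑-pick : ∀ {n} {P : Fin n → Set} (P? : ∀ i → Dec (P i)) (f : Fin n → ℕ) i₀ →
  (∀ {i} → P i → i ≡ i₀) → P i₀ → ∑ (λ i → 𝟙 (P? i) * f i) ≡ f i₀
∑-pick P? f i₀ unique p₀ = trans
  (∑-single _ i₀ (λ i i≢i₀ → cong (_* f i) (𝟙-no (P? i) (i≢i₀ ∘ unique))))
  (trans (cong (_* f i₀) (𝟙-yes (P? i₀) p₀)) (*-identityˡ _))

∑-unique : ∀ {n} {P : Fin n → Set} (P? : ∀ i → Dec (P i)) i₀ →
  (∀ {i} → P i → i ≡ i₀) → P i₀ → ∑ (λ i → 𝟙 (P? i)) ≡ 1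
∑-unique P? i₀ unique p₀ = trans
  (∑-single _ i₀ (λ i i≢i₀ → 𝟙-no (P? i) (i≢i₀ ∘ unique))) (𝟙-yes (P? i₀) p₀)

sumL-allFin : ∀ {n} (f : Fin n → ℕ) → sumL f (allFin n) ≡ ∑ f
sumL-allFin {n} f = trans (cong sumᴸ (map-tabulate id f)) (go f)
  where
  go : ∀ {n} (f : Fin n → ℕ) → sumᴸ (tabulate f) ≡ ∑ f
  go {zero}  f = refl
  go {suc n} f = cong (f zero +_) (go (f ∘ suc))

module _ {A : Set} where

  sumL-++ : ∀ (f : A → ℕ) xs ys → sumL f (xs ++ ys) ≡ sumL f xs + sumL f ys
  sumL-++ f xs ys = trans (cong sumᴸ (map-++ f xs ys)) (sum-++ (map f xs) (map f ys))

  sumL-cong : ∀ {f g : A → ℕ} → (∀ x → f x ≡ g x) → ∀ xs → sumL f xs ≡ sumL g xs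
  sumL-cong f≗g []       = refl
  sumL-cong f≗g (x ∷ xs) = cong₂ _+_ (f≗g x) (sumL-cong f≗g xs)

  sumL-concatMap : ∀ {B : Set} (f : A → ℕ) (g : B → List A) ys →
    sumL f (concatMap g ys) ≡ sumL (λ y → sumL f (g y)) ys
  sumL-concatMap f g []       = refl
  sumL-concatMap f g (y ∷ ys) =
    trans (sumL-++ f (g y) (concatMap g ys)) (cong (sumL f (g y) +_) (sumL-concatMap f g ys))

  sumL-map-allFin : ∀ {n} (f : A → ℕ) (g : Fin n → A) → sumL f (map g (allFin n)) ≡ ∑ (f ∘ g)
  sumL-map-allFin {n} f g = trans (cong sumᴸ (sym (map-∘ {g = f} {f = g} (allFin n)))) (sumL-allFin (f ∘ g))

  sumL-concatMap-allFin : ∀ {n} (f : A → ℕ) (g : Fin n → List A) →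
    sumL f (concatMap g (allFin n)) ≡ ∑ (λ i → sumL f (g i))
  sumL-concatMap-allFin {n} f g =
    trans (sumL-concatMap f g (allFin n)) (sumL-allFin (λ i → sumL f (g i)))

-- Cyclic groups and idempotent quasigroups

-- The integers modulo `suc M`, used later only through these laws. `cycSuc≡⊕one` ties the group to
-- the order of vertices on a cycle, and `sum≡M` reads a natural-number sum `M` as the residue -1.
record CyclicGroup (M : ℕ) : Set where
  infixl 6 _⊕_ _⊝_
  infix 8 ⊖_
  field
    _⊕_            : Fin (suc M) → Fin (suc M) → Fin (suc M)
    ⊖_             : Fin (suc M) → Fin (suc M)
    one            : Fin (suc M)
    isAbelianGroup : IsAbelianGroup _≡_ _⊕_ zero ⊖_
    cycSuc≡⊕one    : ∀ a → cycSuc a ≡ a ⊕ one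
    sum≡M          : ∀ {a b} → toℕ a + toℕ b ≡ M → a ⊕ b ≡ ⊖ one

  open IsAbelianGroup isAbelianGroup public using (assoc; comm; identityˡ; identityʳ; inverseˡ; inverseʳ)

  _⊝_ : Fin (suc M) → Fin (suc M) → Fin (suc M)
  a ⊝ b = a ⊕ ⊖ b

  ⊕-⊝ : ∀ a b → a ⊕ b ⊝ b ≡ a
  ⊕-⊝ a b = trans (assoc a b (⊖ b)) (trans (cong (a ⊕_) (inverseʳ b)) (identityʳ a))

  ⊝-⊕ : ∀ a b → a ⊝ b ⊕ b ≡ a
  ⊝-⊕ a b = trans (assoc a (⊖ b) b) (trans (cong (a ⊕_) (inverseˡ b)) (identityʳ a))

  ⊕⇒⊝ : ∀ {a b c} → a ⊕ b ≡ c → a ≡ c ⊝ b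
  ⊕⇒⊝ {a} {b} refl = sym (⊕-⊝ a b)

  ⊝⇒⊕ : ∀ {a b c} → a ⊝ b ≡ c → a ≡ c ⊕ b
  ⊝⇒⊕ {a} {b} refl = sym (⊝-⊕ a b)

  ⊕-cancelʳ : ∀ {a b} c → a ⊕ c ≡ b ⊕ c → a ≡ b
  ⊕-cancelʳ {b = b} c p = trans (⊕⇒⊝ p) (⊕-⊝ b c)

  ⊕-cancelˡ : ∀ {a b} c → c ⊕ a ≡ c ⊕ b → a ≡ b
  ⊕-cancelˡ {a} {b} c p = ⊕-cancelʳ c (trans (comm a c) (trans p (comm c b)))

  ⊝-involutive : ∀ a b → a ⊝ (a ⊝ b) ≡ b
  ⊝-involutive a b = sym (⊕⇒⊝ (trans (comm b (a ⊝ b)) (⊝-⊕ a b)))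

  interchange : ∀ a b c d → (a ⊕ b) ⊕ (c ⊕ d) ≡ (a ⊕ c) ⊕ (b ⊕ d)
  interchange a b c d = begin
    (a ⊕ b) ⊕ (c ⊕ d) ≡⟨ assoc a b (c ⊕ d) ⟩
    a ⊕ (b ⊕ (c ⊕ d)) ≡⟨ cong (a ⊕_) (assoc b c d) ⟨
    a ⊕ ((b ⊕ c) ⊕ d) ≡⟨ cong (λ x → a ⊕ (x ⊕ d)) (comm b c) ⟩
    a ⊕ ((c ⊕ b) ⊕ d) ≡⟨ cong (a ⊕_) (assoc c b d) ⟩
    a ⊕ (c ⊕ (b ⊕ d)) ≡⟨ assoc a c (b ⊕ d) ⟨
    (a ⊕ c) ⊕ (b ⊕ d) ∎
    where open ≡-Reasoning

  -- `opposite a` complements `a` to `M` as a natural number, hence to -1 as a residue; by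
  -- cancellation `b` must be `opposite a`.
  sum≡M⁻¹ : ∀ {a b} → a ⊕ b ≡ ⊖ one → toℕ a + toℕ b ≡ M
  sum≡M⁻¹ {a} {b} p = trans (cong (λ c → toℕ a + toℕ c) b≡) a+opposite
    where
    a+opposite : toℕ a + toℕ (opposite a) ≡ M
    a+opposite = trans (cong (toℕ a +_) (opposite-prop a)) (m+[n∸m]≡n (≤-pred (toℕ<n a)))
    b≡ : b ≡ opposite a
    b≡ = ⊕-cancelˡ a (trans p (sym (sum≡M a+opposite)))

-- Residues modulo `N`, built from integer congruences

module Modular (M : ℕ) where

  N : ℕ
  N = suc M

  -- Congruence modulo `N` with its quotient as an explicit witness, so that each compatibility law
  -- comes down to a ring identity.
  infix 4 _≈_
  record _≈_ (x y : ℤ) : Set where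
    constructor via
    field
      quotient : ℤ
      equation : x ≡ y +ᶻ quotient *ᶻ ⁺ N

  toℤ : Fin N → ℤ
  toℤ a = ⁺ toℕ a

  [_] : ℤ → Fin N
  [ z ] = fromℕ< (n%ℕd<d z N)

  ≡⇒≈ : ∀ {x y} → x ≡ y → x ≈ y
  ≡⇒≈ {x} refl = via 0ℤ (lem x (⁺ N))
    where
    lem : ∀ x n → x ≡ x +ᶻ 0ℤ *ᶻ n
    lem = solveᶻ-∀

  ≈-sym : ∀ {x y} → x ≈ y → y ≈ x
  ≈-sym {y = y} (via q refl) = via (-ᶻ q) (lem y q (⁺ N))
    where
    lem : ∀ y q n → y ≡ y +ᶻ q *ᶻ n +ᶻ (-ᶻ q) *ᶻ n
    lem = solveᶻ-∀

  ≈-trans : ∀ {x y z} → x ≈ y → y ≈ z → x ≈ z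
  ≈-trans {z = z} (via q refl) (via r refl) = via (r +ᶻ q) (lem z q r (⁺ N))
    where
    lem : ∀ z q r n → z +ᶻ r *ᶻ n +ᶻ q *ᶻ n ≡ z +ᶻ (r +ᶻ q) *ᶻ n
    lem = solveᶻ-∀

  ≈-+ : ∀ {x y x′ y′} → x ≈ y → x′ ≈ y′ → x +ᶻ x′ ≈ y +ᶻ y′
  ≈-+ {y = y} {y′ = y′} (via q refl) (via r refl) = via (q +ᶻ r) (lem y y′ q r (⁺ N))
    where
    lem : ∀ y y′ q r n → y +ᶻ q *ᶻ n +ᶻ (y′ +ᶻ r *ᶻ n) ≡ y +ᶻ y′ +ᶻ (q +ᶻ r) *ᶻ n
    lem = solveᶻ-∀

  ≈-* : ∀ c {x y} → x ≈ y → c *ᶻ x ≈ c *ᶻ y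
  ≈-* c {y = y} (via q refl) = via (c *ᶻ q) (lem c y q (⁺ N))
    where
    lem : ∀ c y q n → c *ᶻ (y +ᶻ q *ᶻ n) ≡ c *ᶻ y +ᶻ c *ᶻ q *ᶻ n
    lem = solveᶻ-∀

  ≈-neg : ∀ {x y} → x ≈ y → -ᶻ x ≈ -ᶻ y
  ≈-neg {y = y} (via q refl) = via (-ᶻ q) (lem y q (⁺ N))
    where
    lem : ∀ y q n → -ᶻ (y +ᶻ q *ᶻ n) ≡ -ᶻ y +ᶻ (-ᶻ q) *ᶻ n
    lem = solveᶻ-∀

  toℤ[_] : ∀ z → toℤ [ z ] ≈ z
  toℤ[ z ] = ≈-sym (via (z /ℕ N) (trans (a≡a%ℕn+[a/ℕn]*n z N)
    (cong (λ r → ⁺ r +ᶻ (z /ℕ N) *ᶻ ⁺ N) (sym (toℕ-fromℕ< (n%ℕd<d z N))))))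

  -- A positive quotient would make `toℕ a` at least `N`; a negative one becomes positive when `a`
  -- and `b` are exchanged.
  ≈⇒≡ : ∀ {a b : Fin N} → toℤ a ≈ toℤ b → a ≡ b
  ≈⇒≡ {a} {b} (via (⁺ zero) eq) = toℕ-injective (ℤ.+-injective (trans eq (ℤ.+-identityʳ _)))
  ≈⇒≡ {a} {b} (via (⁺ suc q) eq) = ⊥-elim (<⇒≱ (toℕ<n a) (too-large (toℕ a) (toℕ b) q eq))
    where
    too-large : ∀ i j q → ⁺ i ≡ ⁺ j +ᶻ ⁺ suc q *ᶻ ⁺ N → N ≤ i
    too-large i j q eq = subst (N ≤_) (sym i≡) (≤-trans (m≤m+n N (q * N)) (m≤n+m _ j))
      where
      i≡ : i ≡ j + suc q * N
      i≡ = ℤ.+-injective (trans eq (cong (⁺ j +ᶻ_) (sym (ℤ.pos-* (suc q) N))))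
  ≈⇒≡ {a} {b} (via -[1+ q ] eq) = sym (≈⇒≡ {b} {a} (via (⁺ suc q) (lem (toℤ a) (toℤ b) (⁺ suc q) (⁺ N) eq)))
    where
    lem′ : ∀ y q n → y ≡ y +ᶻ (-ᶻ q) *ᶻ n +ᶻ q *ᶻ n
    lem′ = solveᶻ-∀
    lem : ∀ x y q n → x ≡ y +ᶻ (-ᶻ q) *ᶻ n → y ≡ x +ᶻ q *ᶻ n
    lem x y q n refl = lem′ y q n

  []-unique : ∀ {z a} → toℤ a ≈ z → a ≡ [ z ]
  []-unique {z} p = ≈⇒≡ (≈-trans p (≈-sym toℤ[ z ]))

  N≈0 : ⁺ N ≈ 0ℤ
  N≈0 = via 1ℤ (lem (⁺ N))
    where
    lem : ∀ n → n ≡ 0ℤ +ᶻ 1ℤ *ᶻ n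
    lem = solveᶻ-∀

  toℤ-cycSuc : ∀ (i : Fin N) → toℤ (cycSuc i) ≈ toℤ i +ᶻ 1ℤ
  toℤ-cycSuc i with M ℕ.≟ toℕ i
  ... | yes eq = ≈-sym (≈-trans (≡⇒≈ (cong ⁺_ (trans (+-comm (toℕ i) 1) (cong suc (sym eq))))) N≈0)
  ... | no p   = ≡⇒≈ (cong ⁺_ (trans (cong suc (toℕ-lower₁ i p)) (+-comm 1 (toℕ i))))

  []-cong : ∀ {x y} → x ≈ y → [ x ] ≡ [ y ]
  []-cong {x} p = []-unique (≈-trans toℤ[ x ] p)

  ∃[] : ∀ a → a ≡ [ toℤ a ]
  ∃[] a = []-unique (≡⇒≈ refl)

  _⊕_ : Fin N → Fin N → Fin N
  a ⊕ b = [ toℤ a +ᶻ toℤ b ]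

  ⊖_ : Fin N → Fin N
  ⊖ a = [ -ᶻ toℤ a ]

  []-⊕ : ∀ x y → [ x ] ⊕ [ y ] ≡ [ x +ᶻ y ]
  []-⊕ x y = []-cong (≈-+ {toℤ [ x ]} {x} {toℤ [ y ]} {y} toℤ[ x ] toℤ[ y ])

  []-⊖ : ∀ x → ⊖ [ x ] ≡ [ -ᶻ x ]
  []-⊖ x = []-cong (≈-neg {toℤ [ x ]} {x} toℤ[ x ])

  ⊕-assoc : ∀ a b c → (a ⊕ b) ⊕ c ≡ a ⊕ (b ⊕ c)
  ⊕-assoc a b c = begin
    [ x +ᶻ y ] ⊕ c       ≡⟨ cong ([ x +ᶻ y ] ⊕_) (∃[] c) ⟩
    [ x +ᶻ y ] ⊕ [ z ]   ≡⟨ []-⊕ (x +ᶻ y) z ⟩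
    [ x +ᶻ y +ᶻ z ]      ≡⟨ cong [_] (ℤ.+-assoc x y z) ⟩
    [ x +ᶻ (y +ᶻ z) ]    ≡⟨ []-⊕ x (y +ᶻ z) ⟨
    [ x ] ⊕ [ y +ᶻ z ]   ≡⟨ cong (_⊕ [ y +ᶻ z ]) (∃[] a) ⟨
    a ⊕ [ y +ᶻ z ]       ∎
    where
    open ≡-Reasoning
    x = toℤ a
    y = toℤ b
    z = toℤ c

  ⊕-comm : ∀ a b → a ⊕ b ≡ b ⊕ a
  ⊕-comm a b = cong [_] (ℤ.+-comm (toℤ a) (toℤ b))

  ⊕-identityˡ : ∀ a → zero ⊕ a ≡ a
  ⊕-identityˡ a = trans (cong [_] (ℤ.+-identityˡ (toℤ a))) (sym (∃[] a))

  ⊕-inverseˡ : ∀ a → (⊖ a) ⊕ a ≡ zero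
  ⊕-inverseˡ a = begin
    [ -ᶻ x ] ⊕ a      ≡⟨ cong ([ -ᶻ x ] ⊕_) (∃[] a) ⟩
    [ -ᶻ x ] ⊕ [ x ]  ≡⟨ []-⊕ (-ᶻ x) x ⟩
    [ -ᶻ x +ᶻ x ]     ≡⟨ cong [_] (ℤ.+-inverseˡ x) ⟩
    [ 0ℤ ]            ≡⟨ ∃[] zero ⟨
    zero              ∎
    where
    open ≡-Reasoning
    x = toℤ a

  ⊕-isAbelianGroup : IsAbelianGroup _≡_ _⊕_ zero ⊖_
  ⊕-isAbelianGroup = record
    { isGroup = record
      { isMonoid = record
        { isSemigroup = record
          { isMagma = record { isEquivalence = isEquivalence ; ∙-cong = cong₂ _⊕_ }
          ; assoc = ⊕-assoc }
        ; identity = ⊕-identityˡ , λ a → trans (⊕-comm a zero) (⊕-identityˡ a) }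
      ; inverse = ⊕-inverseˡ , λ a → trans (⊕-comm a (⊖ a)) (⊕-inverseˡ a)
      ; ⁻¹-cong = cong ⊖_ }
    ; comm = ⊕-comm }

  cyclicGroup : CyclicGroup M
  cyclicGroup = record
    { _⊕_            = _⊕_
    ; ⊖_             = ⊖_
    ; one            = [ 1ℤ ]
    ; isAbelianGroup = ⊕-isAbelianGroup
    ; cycSuc≡⊕one    = λ a → trans ([]-unique (toℤ-cycSuc a))
        (trans (sym ([]-⊕ (toℤ a) 1ℤ)) (cong (_⊕ [ 1ℤ ]) (sym (∃[] a))))
    ; sum≡M          = λ a+b≡M → trans ([]-cong (≈-trans (≡⇒≈ (cong ⁺_ a+b≡M)) M≈-1)) (sym ([]-⊖ 1ℤ))
    }
    where
    M≈-1 : ⁺ M ≈ -ᶻ 1ℤ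
    M≈-1 = via 1ℤ (lem (⁺ M))
      where
      lem : ∀ m → m ≡ -ᶻ 1ℤ +ᶻ 1ℤ *ᶻ (1ℤ +ᶻ m)
      lem = solveᶻ-∀

-- Halving modulo an odd number

record OddCyclicGroup (n : ℕ) : Set where
  field
    cyclic : CyclicGroup (n + n)
  open CyclicGroup cyclic public
  field
    halve        : Fin (suc (n + n)) → Fin (suc (n + n))
    halve⊕halve  : ∀ a → halve a ⊕ halve a ≡ a
    halve-double : ∀ a → halve (a ⊕ a) ≡ a

  double⇒halve : ∀ {a b} → a ⊕ a ≡ b → a ≡ halve b
  double⇒halve {a} refl = sym (halve-double a)

oddCyclicGroup : ∀ n → OddCyclicGroup n
oddCyclicGroup n = record
  { cyclic       = cyclicGroup
  -- `suc n` is the inverse of 2, since 2(n + 1) exceeds the modulus 2n + 1 by one.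
  ; halve        = λ a → [ ⁺ suc n *ᶻ toℤ a ]
  ; halve⊕halve  = λ a → trans ([]-⊕ (⁺ suc n *ᶻ toℤ a) (⁺ suc n *ᶻ toℤ a))
      (trans ([]-cong (double-inverse (toℤ a))) (sym (∃[] a)))
  ; halve-double = λ a → sym ([]-unique (≈-sym (≈-trans (≈-* (⁺ suc n) toℤ[ toℤ a +ᶻ toℤ a ])
      (≈-trans (≡⇒≈ (distrib (⁺ suc n) (toℤ a))) (double-inverse (toℤ a))))))
  }
  where
  open Modular (n + n)
  distrib : ∀ n z → n *ᶻ (z +ᶻ z) ≡ n *ᶻ z +ᶻ n *ᶻ z
  distrib = solveᶻ-∀
  double-inverse : ∀ z → ⁺ suc n *ᶻ z +ᶻ ⁺ suc n *ᶻ z ≈ z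
  double-inverse z = via z (lem (⁺ n) z)
    where
    lem : ∀ n z → (1ℤ +ᶻ n) *ᶻ z +ᶻ (1ℤ +ᶻ n) *ᶻ z ≡ z +ᶻ z *ᶻ (1ℤ +ᶻ (n +ᶻ n))
    lem = solveᶻ-∀

-- Idempotent quasigroups of order 4x

record IdempotentQuasigroup (u : ℕ) : Set where
  infixl 7 _∙_ _\\_ _//_
  field
    _∙_ _\\_ _//_ : Fin u → Fin u → Fin u
    idem          : ∀ v → v ∙ v ≡ v
    ∙-\\          : ∀ v j → v ∙ (v \\ j) ≡ j
    \\-∙          : ∀ v i → v \\ (v ∙ i) ≡ i
    //-∙          : ∀ j i → (j // i) ∙ i ≡ j
    ∙-//          : ∀ v i → (v ∙ i) // i ≡ v

  \\-unique : ∀ {v i j} → v ∙ i ≡ j → i ≡ v \\ j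
  \\-unique {v} {i} refl = sym (\\-∙ v i)

  //-unique : ∀ {v i j} → v ∙ i ≡ j → v ≡ j // i
  //-unique {v} {i} refl = sym (∙-// v i)

  -- Since `i ∙ i ≡ i` as well, right division leaves `v ≡ i`. This puts the two ends of each cycle
  -- edge in different parts.
  ∙-fixed : ∀ {v i} → v ∙ i ≡ i → v ≡ i
  ∙-fixed {i = i} p = trans (//-unique p) (sym (//-unique (idem i)))

-- On ℤ/N ∪ {∞}, with zero for ∞, take the idempotent operation v ∙ i = 2v − i
-- and prolong it along the transversal i = v + 1.
module Prolongation {n : ℕ} (G : OddCyclicGroup (suc n)) where
  open OddCyclicGroup G
  open ≡-Reasoning

  private
    N : ℕ
    N = suc (suc n + suc n)

  -- The parameter `suc n` makes the modulus at least 3, so `cycSuc zero` computes to a successor.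
  one≢0 : one ≢ zero
  one≢0 p with trans (cycSuc≡⊕one zero) (trans (cong (zero ⊕_) p) (identityˡ zero))
  ... | ()

  a≢a⊕one : ∀ {a} → a ≢ a ⊕ one
  a≢a⊕one {a} p = one≢0 (⊕-cancelˡ a (trans (sym p) (sym (identityʳ a))))

  mul ldiv rdiv : Fin (suc N) → Fin (suc N) → Fin (suc N)
  mul zero    zero    = zero
  -- The transversal cell `(v , v + 1)` held 2v - (v + 1) = v - 1 and now holds ∞. The displaced
  -- entry moves to row ∞, where it reads `i − 2` in column `i`, and to column ∞, where it reads
  -- `v − 1` in row `v`.
  mul zero    (suc i) = suc (i ⊝ one ⊝ one)
  mul (suc v) zero    = suc (v ⊝ one)
  mul (suc v) (suc i) with i F.≟ v ⊕ one
  ... | yes _ = zero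
  ... | no _  = suc (v ⊕ v ⊝ i)

  ldiv zero    zero    = zero
  ldiv zero    (suc j) = suc (j ⊕ one ⊕ one)
  ldiv (suc v) zero    = suc (v ⊕ one)
  ldiv (suc v) (suc j) with j F.≟ v ⊝ one
  ... | yes _ = zero
  ... | no _  = suc (v ⊕ v ⊝ j)

  rdiv zero    zero    = zero
  rdiv (suc j) zero    = suc (j ⊕ one)
  rdiv zero    (suc i) = suc (i ⊝ one)
  rdiv (suc j) (suc i) with j F.≟ i ⊝ one ⊝ one
  ... | yes _ = zero
  ... | no _  = suc (halve (j ⊕ i))

  mul-idem : ∀ v → mul v v ≡ v
  mul-idem zero = refl
  mul-idem (suc v) with v F.≟ v ⊕ one
  ... | yes eq = ⊥-elim (a≢a⊕one eq)
  ... | no _   = cong suc (⊕-⊝ v v)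

  -- With `reflect-suc`: the reflection in `v` exchanges the transversal column `v + 1` with its
  -- displaced entry `v − 1`. Hence off the transversal row `v` never takes the value `v − 1`.
  reflect-pred : ∀ v → v ⊕ v ⊝ (v ⊝ one) ≡ v ⊕ one
  reflect-pred v = sym (⊕⇒⊝ (begin
    (v ⊕ one) ⊕ (v ⊝ one) ≡⟨ interchange v one v (⊖ one) ⟩
    (v ⊕ v) ⊕ (one ⊝ one) ≡⟨ cong (v ⊕ v ⊕_) (inverseʳ one) ⟩
    v ⊕ v ⊕ zero          ≡⟨ identityʳ (v ⊕ v) ⟩
    v ⊕ v                 ∎))

  reflect-suc : ∀ v → v ⊕ v ⊝ (v ⊕ one) ≡ v ⊝ one
  reflect-suc v = trans (cong (v ⊕ v ⊝_) (sym (reflect-pred v))) (⊝-involutive (v ⊕ v) (v ⊝ one))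

  mul-ldiv : ∀ v j → mul v (ldiv v j) ≡ j
  mul-ldiv zero zero = refl
  mul-ldiv zero (suc j) = cong suc (trans (cong (_⊝ one) (⊕-⊝ (j ⊕ one) one)) (⊕-⊝ j one))
  mul-ldiv (suc v) zero with v ⊕ one F.≟ v ⊕ one
  ... | yes _ = refl
  ... | no ¬p = ⊥-elim (¬p refl)
  mul-ldiv (suc v) (suc j) with j F.≟ v ⊝ one
  ... | yes eq = cong suc (sym eq)
  ... | no j≢ with v ⊕ v ⊝ j F.≟ v ⊕ one
  ...   | yes eq = ⊥-elim (j≢ (begin
            j                   ≡⟨ ⊝-involutive (v ⊕ v) j ⟨
            v ⊕ v ⊝ (v ⊕ v ⊝ j) ≡⟨ cong (v ⊕ v ⊝_) eq ⟩
            v ⊕ v ⊝ (v ⊕ one)   ≡⟨ reflect-suc v ⟩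
            v ⊝ one             ∎))
  ...   | no _ = cong suc (⊝-involutive (v ⊕ v) j)

  ldiv-mul : ∀ v i → ldiv v (mul v i) ≡ i
  ldiv-mul zero zero = refl
  ldiv-mul zero (suc i) = cong suc (trans (cong (_⊕ one) (⊝-⊕ (i ⊝ one) one)) (⊝-⊕ i one))
  ldiv-mul (suc v) zero with v ⊝ one F.≟ v ⊝ one
  ... | yes _ = refl
  ... | no ¬p = ⊥-elim (¬p refl)
  ldiv-mul (suc v) (suc i) with i F.≟ v ⊕ one
  ... | yes eq = cong suc (sym eq)
  ... | no i≢ with v ⊕ v ⊝ i F.≟ v ⊝ one
  ...   | yes eq = ⊥-elim (i≢ (begin
            i                   ≡⟨ ⊝-involutive (v ⊕ v) i ⟨
            v ⊕ v ⊝ (v ⊕ v ⊝ i) ≡⟨ cong (v ⊕ v ⊝_) eq ⟩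
            v ⊕ v ⊝ (v ⊝ one)   ≡⟨ reflect-pred v ⟩
            v ⊕ one             ∎))
  ...   | no _ = cong suc (⊝-involutive (v ⊕ v) i)

  rdiv-mul : ∀ v i → rdiv (mul v i) i ≡ v
  rdiv-mul zero zero = refl
  rdiv-mul zero (suc i) with i ⊝ one ⊝ one F.≟ i ⊝ one ⊝ one
  ... | yes _ = refl
  ... | no ¬p = ⊥-elim (¬p refl)
  rdiv-mul (suc v) zero = cong suc (⊝-⊕ v one)
  rdiv-mul (suc v) (suc i) with i F.≟ v ⊕ one
  ... | yes eq = cong suc (trans (cong (_⊝ one) eq) (⊕-⊝ v one))
  ... | no i≢ with v ⊕ v ⊝ i F.≟ i ⊝ one ⊝ one
  -- An entry `i − 2` in column `i` gives 2v = 2(i - 1), and halving leads back to the excluded cell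
  -- `i = v + 1`.
  ...   | yes eq = ⊥-elim (i≢ (sym (trans (cong (_⊕ one) v≡i⊝one) (⊝-⊕ i one))))
    where
    double : v ⊕ v ≡ (i ⊝ one) ⊕ (i ⊝ one)
    double = begin
      v ⊕ v                         ≡⟨ ⊝⇒⊕ eq ⟩
      i ⊝ one ⊝ one ⊕ i             ≡⟨ assoc (i ⊝ one) (⊖ one) i ⟩
      (i ⊝ one) ⊕ (⊖ one ⊕ i)       ≡⟨ cong (i ⊝ one ⊕_) (comm (⊖ one) i) ⟩
      (i ⊝ one) ⊕ (i ⊝ one)         ∎
    v≡i⊝one : v ≡ i ⊝ one
    v≡i⊝one = trans (double⇒halve double) (halve-double (i ⊝ one))
  ...   | no _ = cong suc (trans (cong halve (⊝-⊕ (v ⊕ v) i)) (halve-double v))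

  mul-rdiv : ∀ j i → mul (rdiv j i) i ≡ j
  mul-rdiv zero zero = refl
  mul-rdiv (suc j) zero = cong suc (⊕-⊝ j one)
  mul-rdiv zero (suc i) with i F.≟ i ⊝ one ⊕ one
  ... | yes _ = refl
  ... | no ¬p = ⊥-elim (¬p (sym (⊝-⊕ i one)))
  mul-rdiv (suc j) (suc i) with j F.≟ i ⊝ one ⊝ one
  ... | yes eq = cong suc (sym eq)
  ... | no j≢ with i F.≟ halve (j ⊕ i) ⊕ one
  ...   | yes eq = ⊥-elim (j≢ (begin
            j                     ≡⟨ ⊕⇒⊝ (sym (halve⊕halve (j ⊕ i))) ⟩
            v ⊕ v ⊝ i             ≡⟨ cong (v ⊕ v ⊝_) eq ⟩
            v ⊕ v ⊝ (v ⊕ one)     ≡⟨ reflect-suc v ⟩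
            v ⊝ one               ≡⟨ cong (_⊝ one) (⊕⇒⊝ (sym eq)) ⟩
            i ⊝ one ⊝ one         ∎))
    where
    v = halve (j ⊕ i)
  ...   | no _ = cong suc (trans (cong (_⊝ i) (halve⊕halve (j ⊕ i))) (⊕-⊝ j i))

  idempotentQuasigroup : IdempotentQuasigroup (suc N)
  idempotentQuasigroup = record
    { _∙_  = mul
    ; _\\_ = ldiv
    ; _//_ = rdiv
    ; idem = mul-idem
    ; ∙-\\ = mul-ldiv
    ; \\-∙ = ldiv-mul
    ; //-∙ = mul-rdiv
    ; ∙-// = rdiv-mul
    }

-- From K_g(2) to (K_u × K_g)(2)

cycSuc-wrap : ∀ {n} (i : Fin (suc n)) → toℕ i ≡ n → cycSuc i ≡ zero
cycSuc-wrap {n} i eq with n ℕ.≟ toℕ i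
... | yes _ = refl
... | no ¬p = ⊥-elim (¬p (sym eq))

cycSuc-step : ∀ {n} (i : Fin n) → suc (toℕ i) < n → toℕ (cycSuc i) ≡ suc (toℕ i)
cycSuc-step {suc n} i i+1<n with n ℕ.≟ toℕ i
... | yes eq = ⊥-elim (<-irrefl (sym eq) (≤-pred i+1<n))
... | no ¬p  = cong suc (toℕ-lower₁ i ¬p)

-- Positions on a cycle of length 2h: pos s false = 2s and pos s true = 2s + 1.
pos : ∀ {h} → Fin h → Bool → Fin (h * 2)
pos {suc h} zero    false = zero
pos {suc h} zero    true  = suc zero
pos {suc h} (suc s) σ     = suc (suc (pos s σ))

unpos : ∀ h → Fin (h * 2) → Fin h × Bool
unpos (suc h) zero          = zero , false
unpos (suc h) (suc zero)    = zero , true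
unpos (suc h) (suc (suc t)) = let s , σ = unpos h t in suc s , σ

unpos-pos : ∀ {h} (s : Fin h) σ → unpos h (pos s σ) ≡ (s , σ)
unpos-pos zero    false = refl
unpos-pos zero    true  = refl
unpos-pos (suc s) σ     = cong (λ (s , σ) → suc s , σ) (unpos-pos s σ)

pos-unpos : ∀ h (t : Fin (h * 2)) → let s , σ = unpos h t in pos s σ ≡ t
pos-unpos (suc h) zero          = refl
pos-unpos (suc h) (suc zero)    = refl
pos-unpos (suc h) (suc (suc t)) = cong (λ t → suc (suc t)) (pos-unpos h t)

toℕ-pos-false : ∀ {h} (s : Fin h) → toℕ (pos s false) ≡ toℕ s * 2
toℕ-pos-false zero    = refl
toℕ-pos-false (suc s) = cong (λ t → suc (suc t)) (toℕ-pos-false s)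

toℕ-pos-true : ∀ {h} (s : Fin h) → toℕ (pos s true) ≡ suc (toℕ s * 2)
toℕ-pos-true zero    = refl
toℕ-pos-true (suc s) = cong (λ t → suc (suc t)) (toℕ-pos-true s)

cycSuc-pos-false : ∀ {h} (s : Fin h) → cycSuc (pos s false) ≡ pos s true
cycSuc-pos-false {h} s = toℕ-injective (trans
  (cycSuc-step (pos s false) (subst (_< h * 2) 2s+1 (toℕ<n (pos s true))))
  (sym 2s+1))
  where
  2s+1 : toℕ (pos s true) ≡ suc (toℕ (pos s false))
  2s+1 = trans (toℕ-pos-true s) (cong suc (sym (toℕ-pos-false s)))

cycSuc-pos-true : ∀ {h} (s : Fin h) → cycSuc (pos s true) ≡ pos (cycSuc s) false
cycSuc-pos-true {suc h} s with h ℕ.≟ toℕ s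
... | yes eq = cycSuc-wrap (pos s true) (trans (toℕ-pos-true s) (cong (λ m → suc (m * 2)) (sym eq)))
... | no ¬p  = toℕ-injective (trans
  (cycSuc-step (pos s true) (subst (_< suc h * 2) 2s+2 (toℕ<n (pos (suc (F.lower₁ s ¬p)) false))))
  (sym 2s+2))
  where
  2s+2 : toℕ (pos (suc (F.lower₁ s ¬p)) false) ≡ suc (toℕ (pos s true))
  2s+2 = trans (toℕ-pos-false (suc (F.lower₁ s ¬p)))
    (trans (cong (λ m → suc (suc (m * 2))) (toℕ-lower₁ s ¬p)) (cong suc (sym (toℕ-pos-true s))))

∑-pos : ∀ h (f : Fin (h * 2) → ℕ) → ∑ f ≡ ∑ (λ (s : Fin h) → f (pos s false) + f (pos s true))
∑-pos zero    f = refl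
∑-pos (suc h) f = trans (sym (+-assoc (f zero) (f (suc zero)) _))
  (cong (f zero + f (suc zero) +_) (∑-pos h (λ t → f (suc (suc t)))))

-- The label (σ , d , s) stands for the s-th source (σ = false) or sink (σ = true) of the cycle d.
W : ℕ → ℕ → Set
W y h = Bool × Fin y × Fin h

_≟W_ : ∀ {y h} (w w′ : W y h) → Dec (w ≡ w′)
_≟W_ = ≡-dec Bool._≟_ (≡-dec F._≟_ F._≟_)

-- Number of edges from the source w to the sink w′ in the union of the cycles
-- (false, d, 0), (true, d, 0), (false, d, 1), (true, d, 1), …
arcs : ∀ {y h} → W y h → W y h → ℕ
arcs w (false , _ , _) = 0
arcs w (true , d , s)  = 𝟙 (w ≟W (false , d , s)) + 𝟙 (w ≟W (false , d , cycSuc s))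

edges : ∀ {y h} → W y h → W y h → ℕ
edges w w′ = arcs w w′ + arcs w′ w

-- A C₂ₕ-factorization of K_g(2): each factor is given by a labelling of its vertices by W y h.
record TwoFoldFactorization (y h g : ℕ) : Set where
  field
    labellings : List (Fin g ↔ W y h)
    twice      : ∀ {a b} → a ≢ b → sumL (λ L → edges (Inverse.to L a) (Inverse.to L b)) labellings ≡ 2

∑W : ∀ {y h} (f : W y h → ℕ) → ℕ
∑W f = ∑ (λ d → ∑ (λ s → f (false , d , s) + f (true , d , s)))

∑W-pick : ∀ {y h} (f : W y h → ℕ) w₀ → ∑W (λ w → 𝟙 (w ≟W w₀) * f w) ≡ f w₀
∑W-pick f (σ₀ , d₀ , s₀) =
  trans (∑-single (λ d → ∑ (λ s → F false d s + F true d s)) d₀ (λ d d≢ → ∑-zero _ (λ s →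
    cong₂ _+_ (off false d s (d≢ ∘ cong (proj₁ ∘ proj₂))) (off true d s (d≢ ∘ cong (proj₁ ∘ proj₂))))))
  (trans (∑-single (λ s → F false d₀ s + F true d₀ s) s₀ (λ s s≢ →
    cong₂ _+_ (off false d₀ s (s≢ ∘ cong (proj₂ ∘ proj₂))) (off true d₀ s (s≢ ∘ cong (proj₂ ∘ proj₂)))))
  (here σ₀))
  where
  F : Bool → Fin _ → Fin _ → ℕ
  F σ d s = 𝟙 ((σ , d , s) ≟W (σ₀ , d₀ , s₀)) * f (σ , d , s)
  off : ∀ σ d s → (σ , d , s) ≢ (σ₀ , d₀ , s₀) → F σ d s ≡ 0
  off σ d s w≢ = cong (_* f (σ , d , s)) (𝟙-no ((σ , d , s) ≟W (σ₀ , d₀ , s₀)) w≢)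
  at : ∀ w → 𝟙 (w ≟W w) * f w ≡ f w
  at w = trans (cong (_* f w) (𝟙-yes (w ≟W w) refl)) (*-identityˡ (f w))
  here : ∀ σ → 𝟙 ((false , d₀ , s₀) ≟W (σ , d₀ , s₀)) * f (false , d₀ , s₀)
             + 𝟙 ((true , d₀ , s₀) ≟W (σ , d₀ , s₀)) * f (true , d₀ , s₀) ≡ f (σ , d₀ , s₀)
  here false = trans (+-identityʳ _) (at (false , d₀ , s₀))
  here true  = at (true , d₀ , s₀)

-- The contribution of the `s`-th sink of cycle `d`: its two neighbours are the sources `s` and
-- `cycSuc s`.
cycleArcs : ∀ {y h} → W y h → W y h → Fin y → Fin h → ℕ
cycleArcs w w′ d s = 𝟙 ((true , d , s) ≟W w′) * (𝟙 ((false , d , s) ≟W w) + 𝟙 ((false , d , cycSuc s) ≟W w))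

-- Every edge has exactly one sink as an end, so summing over the sinks meets each edge once.
∑∑-arcs : ∀ {y h} (w w′ : W y h) → ∑ (λ d → ∑ (cycleArcs w w′ d)) ≡ arcs w w′
∑∑-arcs w w′ = trans
  -- Zero terms for the sources are inserted, which turns the double sum into a sum over all labels
  -- with `weight` zero on sources.
  (sum-cong-≗ (λ d → sum-cong-≗ (λ s → cong (_+ 𝟙 ((true , d , s) ≟W w′) * weight (true , d , s))
    (sym (*-zeroʳ (𝟙 ((false , d , s) ≟W w′)))))))
  (trans (∑W-pick weight w′) (weight≡arcs w′))
  where
  weight : W _ _ → ℕ
  weight (false , _ , _) = 0
  weight (true , d , s)  = 𝟙 ((false , d , s) ≟W w) + 𝟙 ((false , d , cycSuc s) ≟W w)
  weight≡arcs : ∀ w′ → weight w′ ≡ arcs w w′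
  weight≡arcs (false , _ , _) = refl
  weight≡arcs (true , d , s)  = cong₂ _+_ (𝟙-cong (_ ≟W w) (w ≟W _) sym sym) (𝟙-cong (_ ≟W w) (w ≟W _) sym sym)

∑-linear : ∀ {n} p q (f g : Fin n → ℕ) → ∑ (λ i → p * f i + q * g i) ≡ p * ∑ f + q * ∑ g
∑-linear p q f g = trans (∑-distrib-+ (λ i → p * f i) (λ i → q * g i))
  (cong₂ _+_ (sym (*-distribˡ-sum p f)) (sym (*-distribˡ-sum q g)))

-- Partial factors obtained by placing sources and sinks in different parts

module Assembly {u y h g : ℕ} (Q : IdempotentQuasigroup u) (T : TwoFoldFactorization y h g) where
  open IdempotentQuasigroup Q
  open TwoFoldFactorization T

  module Factor (v : Fin u) (L : Fin g ↔ W y h) where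
    open Inverse L using (to; from; strictlyInverseˡ; strictlyInverseʳ)

    from⇒to : ∀ {w a} → from w ≡ a → w ≡ to a
    from⇒to {w} refl = sym (strictlyInverseˡ w)

    to⇒from : ∀ {w a} → w ≡ to a → from w ≡ a
    to⇒from {a = a} refl = strictlyInverseʳ a

    part : Bool → Fin u → Fin u
    part false i = i
    part true  i = v ∙ i

    point : Fin u → Fin y → Fin h × Bool → Vtx u g
    point i d (s , σ) = part σ i , from (σ , d , s)

    point-injective : ∀ i d {p q} → point i d p ≡ point i d q → p ≡ q
    point-injective i d {s , σ} {s′ , σ′} eq
      with refl ← trans (from⇒to (,-injectiveʳ eq)) (strictlyInverseˡ (σ′ , d , s′)) = refl

    from-≢ : ∀ d s s′ → from (false , d , s) ≢ from (true , d , s′)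
    from-≢ d s s′ eq with trans (from⇒to eq) (strictlyInverseˡ (true , d , s′))
    ... | ()

    -- Consecutive vertices are a source and a sink: their parts differ by `∙-fixed`, their second
    -- coordinates because the labels differ.
    point-adj : ∀ {i} d → i ≢ v → ∀ s σ →
      Adj (point i d (s , σ)) (point i d (unpos h (cycSuc (pos s σ))))
    point-adj {i} d i≢v s false
      rewrite cycSuc-pos-false s | unpos-pos s true =
      (λ eq → i≢v (sym (∙-fixed (sym eq)))) , from-≢ d s s
    point-adj {i} d i≢v s true
      rewrite cycSuc-pos-true s | unpos-pos (cycSuc s) false =
      (λ eq → i≢v (sym (∙-fixed eq))) , λ eq → from-≢ d (cycSuc s) s (sym eq)

    cycle : ∀ i → i ≢ v → Fin y → Cycle (h * 2) u g
    cycle i i≢v d = record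
      { vert = point i d ∘ unpos h
      ; inj  = λ {t} {t′} eq → trans (sym (pos-unpos h t))
          (trans (cong (λ (s , σ) → pos s σ) (point-injective i d {unpos h t} {unpos h t′} eq)) (pos-unpos h t′))
      ; adj  = λ t → let s , σ = unpos h t in
          subst (λ t′ → Adj (point i d (unpos h t)) (point i d (unpos h (cycSuc t′)))) (pos-unpos h t)
            (point-adj d i≢v s σ)
      }

    row : Fin u → List (Cycle (h * 2) u g)
    row i with i F.≟ v
    -- Sources placed in part `v` would have their sinks in `v ∙ v`, which is `v` again, and `v` is
    -- the part to be missed.
    ... | yes _  = []
    ... | no i≢v = map (cycle i i≢v) (allFin y)

    𝟙-point : ∀ i d s σ j a → 𝟙 (point i d (s , σ) ≟V (j , a)) ≡ 𝟙 (part σ i F.≟ j) * 𝟙 ((σ , d , s) ≟W to a)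
    𝟙-point i d s σ j a = trans
      (𝟙-cong (point i d (s , σ) ≟V (j , a)) ((part σ i F.≟ j) ×-dec ((σ , d , s) ≟W to a))
        (λ eq → ,-injectiveˡ eq , from⇒to (,-injectiveʳ eq))
        (λ (p , q) → cong₂ _,_ p (to⇒from q)))
      (𝟙-× (part σ i F.≟ j) ((σ , d , s) ≟W to a))

    vOcc-cycle : ∀ i i≢v d j a → vOcc (cycle i i≢v d) (j , a) ≡ ∑ (λ s →
        𝟙 ((false , d , s) ≟W to a) * 𝟙 (part false i F.≟ j)
      + 𝟙 ((true , d , s) ≟W to a) * 𝟙 (part true i F.≟ j))
    vOcc-cycle i i≢v d j a = trans (sumL-allFin at) (trans (∑-pos h at) (sum-cong-≗ (λ s →
      cong₂ _+_ (at-pos s false) (at-pos s true))))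
      where
      at : Fin (h * 2) → ℕ
      at t = 𝟙 (point i d (unpos h t) ≟V (j , a))
      at-pos : ∀ s σ → at (pos s σ) ≡ 𝟙 ((σ , d , s) ≟W to a) * 𝟙 (part σ i F.≟ j)
      at-pos s σ = trans (cong (λ p → 𝟙 (point i d p ≟V (j , a))) (unpos-pos s σ))
        (trans (𝟙-point i d s σ j a) (*-comm (𝟙 (part σ i F.≟ j)) (𝟙 ((σ , d , s) ≟W to a))))

    -- The label of `a` lies on exactly one of the `y` cycles, so a row meets the vertex at most
    -- once; whether it does depends only on the part that holds the sources or sinks.
    vOcc-row : ∀ i j a → sumL (λ c → vOcc c (j , a)) (row i) ≡
      𝟙 (¬? (i F.≟ v) ×-dec (part (proj₁ (to a)) i F.≟ j))
    vOcc-row i j a with i F.≟ v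
    ... | yes _  = refl
    ... | no i≢v = trans (sumL-map-allFin (λ c → vOcc c (j , a)) (cycle i i≢v))
      (trans (sum-cong-≗ (λ d → vOcc-cycle i i≢v d j a))
      (trans (∑W-pick (λ w → 𝟙 (part (proj₁ w) i F.≟ j)) (to a))
      (trans (sym (*-identityˡ _)) (sym (𝟙-× (yes i≢v) (part (proj₁ (to a)) i F.≟ j))))))

    part⁻¹ : Bool → Fin u → Fin u
    part⁻¹ false j = j
    part⁻¹ true  j = v \\ j

    part-unique : ∀ σ {i j} → part σ i ≡ j → i ≡ part⁻¹ σ j
    part-unique false eq = eq
    part-unique true  eq = \\-unique eq

    part-part⁻¹ : ∀ σ j → part σ (part⁻¹ σ j) ≡ j
    part-part⁻¹ false j = refl
    part-part⁻¹ true  j = ∙-\\ v j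

    part-v : ∀ σ → part σ v ≡ v
    part-v false = refl
    part-v true  = idem v

    meets? : ∀ j a i → Dec (i ≢ v × part (proj₁ (to a)) i ≡ j)
    meets? j a i = ¬? (i F.≟ v) ×-dec (part (proj₁ (to a)) i F.≟ j)

    vOcc-rows : ∀ j a → sumL (λ c → vOcc c (j , a)) (concatMap row (allFin u)) ≡ ∑ (λ i → 𝟙 (meets? j a i))
    vOcc-rows j a = trans (sumL-concatMap-allFin (λ c → vOcc c (j , a)) row)
      (sum-cong-≗ (λ i → vOcc-row i j a))

    rows-missing : ∀ a → ∑ (λ i → 𝟙 (meets? v a i)) ≡ 0
    rows-missing a = ∑-zero (λ i → 𝟙 (meets? v a i)) (λ i → 𝟙-no (meets? v a i) (λ (i≢v , eq) →
      i≢v (trans (part-unique σ eq) (sym (part-unique σ (part-v σ))))))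
      where
      σ = proj₁ (to a)

    -- For sources and for sinks alike, `part σ` permutes the parts and fixes `v`, so a part other
    -- than `v` comes from exactly one row other than `v`.
    rows-covering : ∀ {j} a → j ≢ v → ∑ (λ i → 𝟙 (meets? j a i)) ≡ 1
    rows-covering {j} a j≢v = ∑-unique (meets? j a) (part⁻¹ σ j) (λ (_ , eq) → part-unique σ eq)
      ((λ eq → j≢v (trans (sym (part-part⁻¹ σ j)) (trans (cong (part σ) eq) (part-v σ)))) , part-part⁻¹ σ j)
      where
      σ = proj₁ (to a)

    factor : PartialFactor (h * 2) u g
    factor = record
      { missing = v
      ; cycles  = concatMap row (allFin u)
      ; cover   = λ (j , a) → (λ { refl → trans (vOcc-rows v a) (rows-missing a) })
                            , (λ j≢v → trans (vOcc-rows j a) (rows-covering a j≢v))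
      }

    module _ {i₁ i₂ : Fin u} (i₁≢i₂ : i₁ ≢ i₂) (x z : Fin g) where

      private
        a b : Vtx u g
        a = i₁ , x
        b = i₂ , z

      -- An edge joins a source in part `i` to a sink in part `v ∙ i`. The two summands distinguish
      -- whether `a` or `b` is the source.
      eOcc-cycle : ∀ i i≢v d → eOcc (cycle i i≢v d) a b ≡
          (𝟙 (i F.≟ i₁) * 𝟙 (v ∙ i F.≟ i₂)) * ∑ (cycleArcs (to x) (to z) d)
        + (𝟙 (i F.≟ i₂) * 𝟙 (v ∙ i F.≟ i₁)) * ∑ (cycleArcs (to z) (to x) d)
      eOcc-cycle i i≢v d =
        trans (sumL-allFin (λ t → 𝟙 (joins? (V t) (V (cycSuc t)))))
        (trans (∑-pos h (λ t → 𝟙 (joins? (V t) (V (cycSuc t)))))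
        (trans (sum-cong-≗ pair) (∑-linear p q (cycleArcs (to x) (to z) d) (cycleArcs (to z) (to x) d))))
        where
        V : Fin (h * 2) → Vtx u g
        V t = point i d (unpos h t)
        p q : ℕ
        p = 𝟙 (i F.≟ i₁) * 𝟙 (v ∙ i F.≟ i₂)
        q = 𝟙 (i F.≟ i₂) * 𝟙 (v ∙ i F.≟ i₁)
        joins? : ∀ c c′ → Dec _
        joins? c c′ = ((c ≟V a) ×-dec (c′ ≟V b)) ⊎-dec ((c ≟V b) ×-dec (c′ ≟V a))
        joins : ∀ c c′ → 𝟙 (joins? c c′) ≡ 𝟙 (c ≟V a) * 𝟙 (c′ ≟V b) + 𝟙 (c ≟V b) * 𝟙 (c′ ≟V a)
        joins c c′ = trans (𝟙-⊎ ((c ≟V a) ×-dec (c′ ≟V b)) ((c ≟V b) ×-dec (c′ ≟V a))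
          (λ ((c≡a , _) , (c≡b , _)) → i₁≢i₂ (,-injectiveˡ (trans (sym c≡a) c≡b))))
          (cong₂ _+_ (𝟙-× (c ≟V a) (c′ ≟V b)) (𝟙-× (c ≟V b) (c′ ≟V a)))
        V-pos : ∀ s σ → V (pos s σ) ≡ point i d (s , σ)
        V-pos s σ = cong (point i d) (unpos-pos s σ)
        at : Bool → Fin h → Fin u → Fin g → ℕ
        at σ s j c = 𝟙 (part σ i F.≟ j) * 𝟙 ((σ , d , s) ≟W to c)
        joins-points : ∀ s σ s′ σ′ → 𝟙 (joins? (point i d (s , σ)) (point i d (s′ , σ′))) ≡
          at σ s i₁ x * at σ′ s′ i₂ z + at σ s i₂ z * at σ′ s′ i₁ x
        joins-points s σ s′ σ′ = trans (joins (point i d (s , σ)) (point i d (s′ , σ′))) (cong₂ _+_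
          (cong₂ _*_ (𝟙-point i d s σ i₁ x) (𝟙-point i d s′ σ′ i₂ z))
          (cong₂ _*_ (𝟙-point i d s σ i₂ z) (𝟙-point i d s′ σ′ i₁ x)))
        edge-false : ∀ s → 𝟙 (joins? (V (pos s false)) (V (cycSuc (pos s false)))) ≡
          at false s i₁ x * at true s i₂ z + at false s i₂ z * at true s i₁ x
        edge-false s = trans
          (cong₂ (λ c c′ → 𝟙 (joins? c c′)) (V-pos s false) (trans (cong V (cycSuc-pos-false s)) (V-pos s true)))
          (joins-points s false s true)
        edge-true : ∀ s → 𝟙 (joins? (V (pos s true)) (V (cycSuc (pos s true)))) ≡
          at true s i₁ x * at false (cycSuc s) i₂ z + at true s i₂ z * at false (cycSuc s) i₁ x
        edge-true s = trans
          (cong₂ (λ c c′ → 𝟙 (joins? c c′)) (V-pos s true)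
            (trans (cong V (cycSuc-pos-true s)) (V-pos (cycSuc s) false)))
          (joins-points s true (cycSuc s) false)
        collect : ∀ p₁ p₂ q₁ q₂ fx fz gx gz tx tz →
          (p₁ * fx) * (q₂ * tz) + (p₂ * fz) * (q₁ * tx) + ((q₁ * tx) * (p₂ * gz) + (q₂ * tz) * (p₁ * gx)) ≡
          (p₁ * q₂) * (tz * (fx + gx)) + (p₂ * q₁) * (tx * (fz + gz))
        collect = solve-∀
        -- The edges leaving positions 2s and 2s + 1 are the two edges at the `s`-th sink, that is,
        -- one summand of `cycleArcs`.
        pair : ∀ s → 𝟙 (joins? (V (pos s false)) (V (cycSuc (pos s false))))
                   + 𝟙 (joins? (V (pos s true)) (V (cycSuc (pos s true)))) ≡
          p * cycleArcs (to x) (to z) d s + q * cycleArcs (to z) (to x) d s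
        pair s = trans (cong₂ _+_ (edge-false s) (edge-true s))
          (collect (𝟙 (i F.≟ i₁)) (𝟙 (i F.≟ i₂)) (𝟙 (v ∙ i F.≟ i₁)) (𝟙 (v ∙ i F.≟ i₂))
            (𝟙 ((false , d , s) ≟W to x)) (𝟙 ((false , d , s) ≟W to z))
            (𝟙 ((false , d , cycSuc s) ≟W to x)) (𝟙 ((false , d , cycSuc s) ≟W to z))
            (𝟙 ((true , d , s) ≟W to x)) (𝟙 ((true , d , s) ≟W to z)))

      -- The formula is stated for every `i`, including `v`, so that the rows can be summed without
      -- a case distinction.
      eOcc-row : ∀ i → sumL (λ c → eOcc c a b) (row i) ≡
          arcs (to x) (to z) * (𝟙 (i F.≟ i₁) * 𝟙 (v ∙ i F.≟ i₂))
        + arcs (to z) (to x) * (𝟙 (i F.≟ i₂) * 𝟙 (v ∙ i F.≟ i₁))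
      eOcc-row i with i F.≟ v
      -- The row is empty; the right-hand side vanishes because `v ∙ v ≡ v` cannot link two distinct
      -- parts.
      ... | yes refl = sym (cong₂ _+_
              (trans (cong (arcs (to x) (to z) *_) (vanish i₁≢i₂)) (*-zeroʳ (arcs (to x) (to z))))
              (trans (cong (arcs (to z) (to x) *_) (vanish (i₁≢i₂ ∘ sym))) (*-zeroʳ (arcs (to z) (to x)))))
        where
        vanish : ∀ {j₁ j₂} → j₁ ≢ j₂ → 𝟙 (v F.≟ j₁) * 𝟙 (v ∙ v F.≟ j₂) ≡ 0
        vanish {j₁} {j₂} j₁≢j₂ = trans (sym (𝟙-× (v F.≟ j₁) (v ∙ v F.≟ j₂)))
          (𝟙-no _ (λ (v≡j₁ , vv≡j₂) → j₁≢j₂ (trans (sym v≡j₁) (trans (sym (idem v)) vv≡j₂))))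
      ... | no i≢v = begin
        sumL (λ c → eOcc c a b) (map (cycle i i≢v) (allFin y))
          ≡⟨ sumL-map-allFin (λ c → eOcc c a b) (cycle i i≢v) ⟩
        ∑ (λ d → eOcc (cycle i i≢v d) a b)
          ≡⟨ sum-cong-≗ (eOcc-cycle i i≢v) ⟩
        ∑ (λ d → p * ∑ (cycleArcs (to x) (to z) d) + q * ∑ (cycleArcs (to z) (to x) d))
          ≡⟨ ∑-linear p q (λ d → ∑ (cycleArcs (to x) (to z) d)) (λ d → ∑ (cycleArcs (to z) (to x) d)) ⟩
        p * ∑ (λ d → ∑ (cycleArcs (to x) (to z) d)) + q * ∑ (λ d → ∑ (cycleArcs (to z) (to x) d))
          ≡⟨ cong₂ (λ m n → p * m + q * n) (∑∑-arcs (to x) (to z)) (∑∑-arcs (to z) (to x)) ⟩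
        p * arcs (to x) (to z) + q * arcs (to z) (to x)
          ≡⟨ cong₂ _+_ (*-comm p _) (*-comm q _) ⟩
        arcs (to x) (to z) * p + arcs (to z) (to x) * q ∎
        where
        open ≡-Reasoning
        p q : ℕ
        p = 𝟙 (i F.≟ i₁) * 𝟙 (v ∙ i F.≟ i₂)
        q = 𝟙 (i F.≟ i₂) * 𝟙 (v ∙ i F.≟ i₁)

      eOccF-factor : eOccF factor a b ≡
        arcs (to x) (to z) * 𝟙 (v ∙ i₁ F.≟ i₂) + arcs (to z) (to x) * 𝟙 (v ∙ i₂ F.≟ i₁)
      eOccF-factor = trans (sumL-concatMap-allFin (λ c → eOcc c a b) row)
        (trans (sum-cong-≗ eOcc-row)
        (trans (∑-linear (arcs (to x) (to z)) (arcs (to z) (to x))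
            (λ i → 𝟙 (i F.≟ i₁) * 𝟙 (v ∙ i F.≟ i₂)) (λ i → 𝟙 (i F.≟ i₂) * 𝟙 (v ∙ i F.≟ i₁)))
        (cong₂ (λ m n → arcs (to x) (to z) * m + arcs (to z) (to x) * n)
          (∑-pick (F._≟ i₁) (λ i → 𝟙 (v ∙ i F.≟ i₂)) i₁ id refl)
          (∑-pick (F._≟ i₂) (λ i → 𝟙 (v ∙ i F.≟ i₁)) i₂ id refl))))

  open Factor using (factor; eOccF-factor)

  ∑-// : ∀ i j → ∑ (λ v → 𝟙 (v ∙ i F.≟ j)) ≡ 1
  ∑-// i j = ∑-unique (λ v → v ∙ i F.≟ j) (j // i) //-unique (//-∙ j i)

  factors : (Fin g ↔ W y h) → List (PartialFactor (h * 2) u g)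
  factors L = map (λ v → factor v L) (allFin u)

  -- Exactly one `v` sends `i₁` to `i₂` and exactly one sends `i₂` to `i₁`, so over all `v` each
  -- direction of the edge is counted once.
  eOccF-factors : ∀ {i₁ i₂} → i₁ ≢ i₂ → ∀ x z L →
    sumL (λ F → eOccF F (i₁ , x) (i₂ , z)) (factors L) ≡ edges (Inverse.to L x) (Inverse.to L z)
  eOccF-factors {i₁} {i₂} i₁≢i₂ x z L = begin
    sumL (λ F → eOccF F (i₁ , x) (i₂ , z)) (factors L)
      ≡⟨ sumL-map-allFin (λ F → eOccF F (i₁ , x) (i₂ , z)) (λ v → factor v L) ⟩
    ∑ (λ v → eOccF (factor v L) (i₁ , x) (i₂ , z))
      ≡⟨ sum-cong-≗ (λ v → eOccF-factor v L i₁≢i₂ x z) ⟩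
    ∑ (λ v → p * 𝟙 (v ∙ i₁ F.≟ i₂) + q * 𝟙 (v ∙ i₂ F.≟ i₁))
      ≡⟨ ∑-linear p q (λ v → 𝟙 (v ∙ i₁ F.≟ i₂)) (λ v → 𝟙 (v ∙ i₂ F.≟ i₁)) ⟩
    p * ∑ (λ v → 𝟙 (v ∙ i₁ F.≟ i₂)) + q * ∑ (λ v → 𝟙 (v ∙ i₂ F.≟ i₁))
      ≡⟨ cong₂ (λ m n → p * m + q * n) (∑-// i₁ i₂) (∑-// i₂ i₁) ⟩
    p * 1 + q * 1
      ≡⟨ cong₂ _+_ (*-identityʳ p) (*-identityʳ q) ⟩
    p + q ∎
    where
    open ≡-Reasoning
    p q : ℕ
    p = arcs (Inverse.to L x) (Inverse.to L z)
    q = arcs (Inverse.to L z) (Inverse.to L x)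

  assemble : ARCS (h * 2) u g 2
  assemble = concatMap factors labellings , λ (i₁ , x) (i₂ , z) (i₁≢i₂ , x≢z) →
    trans (sumL-concatMap (λ F → eOccF F (i₁ , x) (i₂ , z)) factors labellings)
    (trans (sumL-cong (eOccF-factors i₁≢i₂ x z) labellings) (twice x≢z))

-- A C_k-factorization of K_g(2)

-- The Hamiltonian cycle (false, 0), (true, 0), (false, 1), (true, 1), … is the union of two 1-factors.
rung rail : ∀ {n} → Bool × Fin n → Bool × Fin n → ℕ
rung (false , s) (false , s′) = 0
rung (false , s) (true  , s′) = 𝟙 (s F.≟ s′)
rung (true  , s) (false , s′) = 𝟙 (s F.≟ s′)
rung (true  , s) (true  , s′) = 0
rail (false , s) (false , s′) = 0
rail (false , s) (true  , s′) = 𝟙 (s F.≟ cycSuc s′)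
rail (true  , s) (false , s′) = 𝟙 (s′ F.≟ cycSuc s)
rail (true  , s) (true  , s′) = 0

rung-irrefl : ∀ {n} (x : Bool × Fin n) → rung x x ≡ 0
rung-irrefl (false , _) = refl
rung-irrefl (true  , _) = refl

-- Translates of a zigzag Hamiltonian cycle on ∞ and the residues modulo 2n + 1

module Zigzag {n : ℕ} (G : OddCyclicGroup n) where
  open OddCyclicGroup G

  private
    M N : ℕ
    M = n + n
    N = suc M

    X : Set
    X = Bool × Fin (suc n)

    size : suc n + suc n ≡ suc N
    size = cong suc (+-suc n n)

  -- The label 0 is the point ∞ and the label a + 1 is the residue a modulo N.
  label : X → Fin (suc N)
  label (false , s) = cast size (s ↑ˡ suc n)
  label (true , s)  = cast size (suc n ↑ʳ opposite s)

  side : Fin (suc n) ⊎ Fin (suc n) → X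
  side (inj₁ s) = false , s
  side (inj₂ s) = true , opposite s

  unlabel : Fin (suc N) → X
  unlabel i = side (splitAt (suc n) (cast (sym size) i))

  unlabel-label : ∀ x → unlabel (label x) ≡ x
  unlabel-label (false , s) = cong side (trans
    (cong (splitAt (suc n)) (cast-involutive (sym size) size (s ↑ˡ suc n)))
    (splitAt-↑ˡ (suc n) s (suc n)))
  unlabel-label (true , s) = trans
    (cong side (trans
      (cong (splitAt (suc n)) (cast-involutive (sym size) size (suc n ↑ʳ opposite s)))
      (splitAt-↑ʳ (suc n) (suc n) (opposite s))))
    (cong (true ,_) (opposite-involutive s))

  label-side : ∀ e → label (side e) ≡ cast size (join (suc n) (suc n) e)
  label-side (inj₁ s) = refl
  label-side (inj₂ s) = cong (λ s → cast size (suc n ↑ʳ s)) (opposite-involutive s)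

  label-unlabel : ∀ i → label (unlabel i) ≡ i
  label-unlabel i = trans (label-side (splitAt (suc n) (cast (sym size) i)))
    (trans (cong (cast size) (join-splitAt (suc n) (suc n) (cast (sym size) i)))
      (cast-involutive size (sym size) i))

  label-injective : ∀ {x x′} → label x ≡ label x′ → x ≡ x′
  label-injective {x} {x′} eq = trans (sym (unlabel-label x)) (trans (cong unlabel eq) (unlabel-label x′))

  -- The residue of the point `(true , s)`, namely `M − s`, in a form that shows the bound
  -- `n ≤ lower s`.
  lower : Fin (suc n) → ℕ
  lower s = n + (n ∸ toℕ s)

  height : X → ℕ
  height (false , s) = toℕ s
  height (true , s)  = suc (lower s)

  toℕ-label : ∀ x → toℕ (label x) ≡ height x
  toℕ-label (false , s) = trans (toℕ-cast size (s ↑ˡ suc n)) (toℕ-↑ˡ s (suc n))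
  toℕ-label (true , s)  = trans (toℕ-cast size (suc n ↑ʳ opposite s))
    (trans (toℕ-↑ʳ (suc n) (opposite s)) (cong (suc n +_) (opposite-prop s)))

  s≤n : ∀ (s : Fin (suc n)) → toℕ s ≤ n
  s≤n s = ≤-pred (toℕ<n s)

  lower+ : ∀ s → lower s + toℕ s ≡ M
  lower+ s = trans (+-assoc n (n ∸ toℕ s) (toℕ s)) (cong (n +_) (m∸n+n≡m (s≤n s)))

  n≤lower : ∀ s → n ≤ lower s
  n≤lower s = m≤m+n n (n ∸ toℕ s)

  translate untranslate : Fin N → Fin (suc N) → Fin (suc N)
  translate c zero      = zero
  translate c (suc a)   = suc (a ⊕ c)
  untranslate c zero    = zero
  untranslate c (suc a) = suc (a ⊝ c)

  T : Fin N → X ↔ X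
  T c = mk↔ₛ′ (unlabel ∘ translate c ∘ label) (unlabel ∘ untranslate c ∘ label)
    (λ x → trans (cong (unlabel ∘ translate c) (label-unlabel (untranslate c (label x))))
      (trans (cong unlabel (tu (label x))) (unlabel-label x)))
    (λ x → trans (cong (unlabel ∘ untranslate c) (label-unlabel (translate c (label x))))
      (trans (cong unlabel (ut (label x))) (unlabel-label x)))
    where
    tu : ∀ i → translate c (untranslate c i) ≡ i
    tu zero    = refl
    tu (suc a) = cong suc (⊝-⊕ a c)
    ut : ∀ i → untranslate c (translate c i) ≡ i
    ut zero    = refl
    ut (suc a) = cong suc (⊕-⊝ a c)

  label-T : ∀ c x → label (Inverse.to (T c) x) ≡ translate c (label x)
  label-T c x = label-unlabel (translate c (label x))

  T-zero : ∀ x → Inverse.to (T zero) x ≡ x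
  T-zero x = trans (cong unlabel (t₀ (label x))) (unlabel-label x)
    where
    t₀ : ∀ i → translate zero i ≡ i
    t₀ zero    = refl
    t₀ (suc a) = cong suc (identityʳ a)

  -- The rung at `s` joins the labels `s` and `N − s`. Two labels on the false side add up to at
  -- most 2n, two on the true side to at least 2n + 2, so neither sum is `N`.
  rung-label : ∀ x x′ → rung x x′ ≡ 𝟙 (toℕ (label x) + toℕ (label x′) ℕ.≟ N)
  rung-label x x′ = trans (cases x x′) (cong₂ (λ l m → 𝟙 (l + m ℕ.≟ N)) (sym (toℕ-label x)) (sym (toℕ-label x′)))
    where
    cases : ∀ x x′ → rung x x′ ≡ 𝟙 (height x + height x′ ℕ.≟ N)
    cases (false , s) (false , s′) = sym (𝟙-no (toℕ s + toℕ s′ ℕ.≟ N)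
      (<⇒≢ (s≤s (+-mono-≤ (s≤n s) (s≤n s′)))))
    cases (false , s) (true , s′) = 𝟙-cong (s F.≟ s′) (toℕ s + suc (lower s′) ℕ.≟ N)
      (λ { refl → trans (+-comm (toℕ s) (suc (lower s))) (cong suc (lower+ s)) })
      (λ eq → toℕ-injective (+-cancelʳ-≡ (suc (lower s′)) (toℕ s) (toℕ s′)
        (trans eq (trans (cong suc (sym (lower+ s′))) (+-comm (suc (lower s′)) (toℕ s′))))))
    cases (true , s) (false , s′) = 𝟙-cong (s F.≟ s′) (suc (lower s) + toℕ s′ ℕ.≟ N)
      (λ { refl → cong suc (lower+ s) })
      (λ eq → toℕ-injective (+-cancelˡ-≡ (suc (lower s)) (toℕ s) (toℕ s′) (trans (cong suc (lower+ s)) (sym eq))))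
    cases (true , s) (true , s′) = sym (𝟙-no (suc (lower s) + suc (lower s′) ℕ.≟ N) (λ eq →
      <⇒≢ (s≤s (≤-trans (s≤s (+-mono-≤ (n≤lower s) (n≤lower s′))) (≤-reflexive (sym (+-suc (lower s) (lower s′))))))
        (sym eq)))

  -- The rails in terms of labels: they join residues with sum `M`, except that the rail closing the
  -- cycle joins ∞ to the label `suc n`.
  Cross : ℕ → ℕ → Set
  Cross zero    m       = m ≡ suc n
  Cross (suc l) zero    = suc l ≡ suc n
  Cross (suc l) (suc m) = l + m ≡ M

  cross? : ∀ l m → Dec (Cross l m)
  cross? zero    m       = m ℕ.≟ suc n
  cross? (suc l) zero    = suc l ℕ.≟ suc n
  cross? (suc l) (suc m) = l + m ℕ.≟ M

  cross-sym : ∀ l m → Cross l m → Cross m l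
  cross-sym zero    (suc m) p = p
  cross-sym (suc l) zero    p = p
  cross-sym (suc l) (suc m) p = trans (+-comm m l) p

  ¬cross-small : ∀ {l m} → l ≤ n → m ≤ n → ¬ Cross l m
  ¬cross-small {zero}  {m}     l≤n m≤n p = <-irrefl p (s≤s m≤n)
  ¬cross-small {suc l} {zero}  l≤n m≤n p = <-irrefl p (s≤s l≤n)
  ¬cross-small {suc l} {suc m} l≤n m≤n p = <-irrefl p (+-mono-<-≤ l≤n (<⇒≤ m≤n))

  cross-large : ∀ {l m} → n ≤ l → n ≤ m → l + m ≡ M → l ≡ n
  cross-large {l} {m} n≤l n≤m p =
    ≤-antisym (+-cancelʳ-≤ n l n (subst (l + n ≤_) p (+-monoʳ-≤ l n≤m))) n≤l

  cycSuc-cross : ∀ s s′ → s ≡ cycSuc s′ → Cross (toℕ s) (suc (lower s′))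
  cycSuc-cross s s′ refl with n ℕ.≟ toℕ s′
  ... | yes eq = cong suc (+-cancelʳ-≡ n (lower s′) n (trans (cong (lower s′ +_) eq) (lower+ s′)))
  ... | no ¬p  = trans (cong (_+ lower s′) (toℕ-lower₁ s′ ¬p)) (trans (+-comm (toℕ s′) (lower s′)) (lower+ s′))

  cross-cycSuc : ∀ s s′ → Cross (toℕ s) (suc (lower s′)) → s ≡ cycSuc s′
  cross-cycSuc zero s′ p = sym (cycSuc-wrap s′ (+-cancelˡ-≡ n (toℕ s′) n
    (trans (cong (_+ toℕ s′) (sym (suc-injective p))) (lower+ s′))))
  cross-cycSuc (suc r) s′ p = toℕ-injective (trans (cong suc r≡s′)
    (sym (cycSuc-step s′ (s≤s (subst (_< n) r≡s′ (toℕ<n r))))))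
    where
    r≡s′ : toℕ r ≡ toℕ s′
    r≡s′ = +-cancelʳ-≡ (lower s′) (toℕ r) (toℕ s′)
      (trans p (trans (sym (lower+ s′)) (+-comm (lower s′) (toℕ s′))))

  -- The residue `n` added to itself gives `M`, so `Cross` relates the label `suc n` to itself
  -- although no rail does. By `cross-large` this is the only such coincidence on the true side, and
  -- `x ≢ x′` rules it out.
  rail-label : ∀ x x′ → x ≢ x′ → rail x x′ ≡ 𝟙 (cross? (toℕ (label x)) (toℕ (label x′)))
  rail-label x x′ x≢x′ =
    trans (cases x x′ x≢x′) (cong₂ (λ l m → 𝟙 (cross? l m)) (sym (toℕ-label x)) (sym (toℕ-label x′)))
    where
    cases : ∀ x x′ → x ≢ x′ → rail x x′ ≡ 𝟙 (cross? (height x) (height x′))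
    cases (false , s) (false , s′) _ = sym (𝟙-no (cross? (toℕ s) (toℕ s′)) (¬cross-small (s≤n s) (s≤n s′)))
    cases (false , s) (true , s′) _ = 𝟙-cong (s F.≟ cycSuc s′) (cross? (toℕ s) (suc (lower s′)))
      (cycSuc-cross s s′) (cross-cycSuc s s′)
    cases (true , s) (false , s′) _ = 𝟙-cong (s′ F.≟ cycSuc s) (cross? (suc (lower s)) (toℕ s′))
      (cross-sym (toℕ s′) (suc (lower s)) ∘ cycSuc-cross s′ s)
      (cross-cycSuc s′ s ∘ cross-sym (suc (lower s)) (toℕ s′))
    cases (true , s) (true , s′) x≢x′ = sym (𝟙-no (lower s + lower s′ ℕ.≟ M) (λ eq →
      let s≡n  = cross-large (n≤lower s) (n≤lower s′) eq
          s′≡n = cross-large (n≤lower s′) (n≤lower s) (trans (+-comm (lower s′) (lower s)) eq)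
      in x≢x′ (label-injective (toℕ-injective (trans (toℕ-label (true , s))
        (trans (cong suc (trans s≡n (sym s′≡n))) (sym (toℕ-label (true , s′)))))))))

  private
    -- The residue -2: labels `a + 1` and `b + 1` with sum `N` belong to residues with sum `N − 2`.
    κ : Fin N
    κ = ⊖ one ⊝ one

  toℕ≡M⇒ : ∀ {a} → toℕ a ≡ M → a ≡ ⊖ one
  toℕ≡M⇒ {a} eq = trans (sym (identityˡ a)) (sum≡M eq)

  toℕ≡M⇐ : ∀ {a} → a ≡ ⊖ one → toℕ a ≡ M
  toℕ≡M⇐ {a} eq = sum≡M⁻¹ (trans (identityˡ a) eq)

  opposed⇒ : ∀ a b → toℕ a + suc (toℕ b) ≡ M → a ⊕ b ≡ κ
  opposed⇒ a b eq = ⊕⇒⊝ (trans (assoc a b one) (trans (cong (a ⊕_) (sym (cycSuc≡⊕one b)))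
    (sum≡M (trans (cong (toℕ a +_) (cycSuc-step b (s≤s (subst (suc (toℕ b) ≤_) eq (m≤n+m _ (toℕ a)))))) eq))))

  -- If `b` is -1, so is `a`, against `a ≢ b`; otherwise adding `one` to `b` does not wrap around.
  opposed⇐ : ∀ a b → a ≢ b → a ⊕ b ≡ κ → toℕ a + suc (toℕ b) ≡ M
  opposed⇐ a b a≢b eq with M ℕ.≟ toℕ b
  ... | yes M≡b = ⊥-elim (a≢b (⊕-cancelʳ b (trans eq (cong₂ _⊕_ (sym b≡) (sym b≡)))))
    where
    b≡ : b ≡ ⊖ one
    b≡ = toℕ≡M⇒ (sym M≡b)
  ... | no M≢b = trans (cong (toℕ a +_) (sym (cycSuc-step b (s≤s (≤∧≢⇒< (≤-pred (toℕ<n b)) (M≢b ∘ sym))))))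
    (sum≡M⁻¹ (trans (cong (a ⊕_) (cycSuc≡⊕one b)) (trans (sym (assoc a b one)) (trans (cong (_⊕ one) eq) (⊝-⊕ (⊖ one) one)))))

  shift-sum : ∀ a b c → (a ⊕ c) ⊕ (b ⊕ c) ≡ (c ⊕ c) ⊕ (a ⊕ b)
  shift-sum a b c = trans (interchange a c b c) (comm (a ⊕ b) (c ⊕ c))

  -- The only translation that takes `a` and `b` to residues with sum `r`; it exists because the
  -- modulus is odd.
  centre : Fin N → Fin N → Fin N → Fin N
  centre r a b = halve (r ⊝ (a ⊕ b))

  centre-unique : ∀ {r} a b {c} → (a ⊕ c) ⊕ (b ⊕ c) ≡ r → c ≡ centre r a b
  centre-unique a b {c} eq = double⇒halve (⊕⇒⊝ (trans (sym (shift-sum a b c)) eq))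

  centre-sum : ∀ r a b → let c = centre r a b in (a ⊕ c) ⊕ (b ⊕ c) ≡ r
  centre-sum r a b = trans (shift-sum a b _) (trans (cong (_⊕ (a ⊕ b)) (halve⊕halve (r ⊝ (a ⊕ b)))) (⊝-⊕ r (a ⊕ b)))

  ⊕-unique : ∀ {r} b {c} → b ⊕ c ≡ r → c ≡ r ⊝ b
  ⊕-unique b {c} eq = ⊕⇒⊝ (trans (comm c b) eq)

  ⊕-solve : ∀ r b → b ⊕ (r ⊝ b) ≡ r
  ⊕-solve r b = trans (comm b (r ⊝ b)) (⊝-⊕ r b)

  -- The residue that the closing rail joins to ∞.
  mid : Fin N
  mid = fromℕ< (s≤s (m≤m+n n n))

  toℕ≡mid⇒ : ∀ {a} → suc (toℕ a) ≡ suc n → a ≡ mid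
  toℕ≡mid⇒ eq = toℕ-injective (trans (suc-injective eq) (sym (toℕ-fromℕ< (s≤s (m≤m+n n n)))))

  toℕ≡mid⇐ : ∀ {a} → a ≡ mid → suc (toℕ a) ≡ suc n
  toℕ≡mid⇐ refl = cong suc (toℕ-fromℕ< (s≤s (m≤m+n n n)))

  -- Exactly one translation makes a given pair a rung: it takes the partner of ∞ to -1, or makes
  -- two residues add up to -2. This is the classical rotational 1-factorization.
  ∑-rung-translate : ∀ i j → i ≢ j → ∑ (λ c → 𝟙 (toℕ (translate c i) + toℕ (translate c j) ℕ.≟ N)) ≡ 1
  ∑-rung-translate zero zero i≢j = ⊥-elim (i≢j refl)
  ∑-rung-translate zero (suc b) _ = ∑-unique (λ c → suc (toℕ (b ⊕ c)) ℕ.≟ N) (⊖ one ⊝ b)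
    (λ eq → ⊕-unique b (toℕ≡M⇒ (suc-injective eq))) (cong suc (toℕ≡M⇐ (⊕-solve (⊖ one) b)))
  ∑-rung-translate (suc a) zero _ = ∑-unique (λ c → suc (toℕ (a ⊕ c)) + 0 ℕ.≟ N) (⊖ one ⊝ a)
    (λ eq → ⊕-unique a (toℕ≡M⇒ (suc-injective (trans (sym (+-identityʳ _)) eq))))
    (trans (+-identityʳ _) (cong suc (toℕ≡M⇐ (⊕-solve (⊖ one) a))))
  ∑-rung-translate (suc a) (suc b) i≢j =
    ∑-unique (λ c → suc (toℕ (a ⊕ c)) + suc (toℕ (b ⊕ c)) ℕ.≟ N) (centre κ a b)
      (λ {c} eq → centre-unique a b (opposed⇒ (a ⊕ c) (b ⊕ c) (suc-injective eq)))
      (cong suc (opposed⇐ (a ⊕ centre κ a b) (b ⊕ centre κ a b)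
        (λ eq → i≢j (cong suc (⊕-cancelʳ _ eq))) (centre-sum κ a b)))

  ∑-rail-translate : ∀ i j → i ≢ j → ∑ (λ c → 𝟙 (cross? (toℕ (translate c i)) (toℕ (translate c j)))) ≡ 1
  ∑-rail-translate zero zero i≢j = ⊥-elim (i≢j refl)
  ∑-rail-translate zero (suc b) _ = ∑-unique (λ c → suc (toℕ (b ⊕ c)) ℕ.≟ suc n) (mid ⊝ b)
    (λ eq → ⊕-unique b (toℕ≡mid⇒ eq)) (toℕ≡mid⇐ (⊕-solve mid b))
  ∑-rail-translate (suc a) zero _ = ∑-unique (λ c → suc (toℕ (a ⊕ c)) ℕ.≟ suc n) (mid ⊝ a)
    (λ eq → ⊕-unique a (toℕ≡mid⇒ eq)) (toℕ≡mid⇐ (⊕-solve mid a))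
  ∑-rail-translate (suc a) (suc b) _ =
    ∑-unique (λ c → toℕ (a ⊕ c) + toℕ (b ⊕ c) ℕ.≟ M) (centre (⊖ one) a b)
      (λ eq → centre-unique a b (sum≡M eq)) (sum≡M⁻¹ (centre-sum (⊖ one) a b))

  -- Together with `∑-rail`, this shows that the translated cycles cover each pair twice. The rungs
  -- alone also serve as the 1-factorization of the set of cells.
  ∑-rung : ∀ x x′ → x ≢ x′ → ∑ (λ c → rung (Inverse.to (T c) x) (Inverse.to (T c) x′)) ≡ 1
  ∑-rung x x′ x≢x′ = trans
    (sum-cong-≗ (λ c → trans (rung-label (Inverse.to (T c) x) (Inverse.to (T c) x′))
      (cong₂ (λ i j → 𝟙 (toℕ i + toℕ j ℕ.≟ N)) (label-T c x) (label-T c x′))))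
    (∑-rung-translate (label x) (label x′) (x≢x′ ∘ label-injective))

  ∑-rail : ∀ x x′ → x ≢ x′ → ∑ (λ c → rail (Inverse.to (T c) x) (Inverse.to (T c) x′)) ≡ 1
  ∑-rail x x′ x≢x′ = trans
    (sum-cong-≗ (λ c → trans (rail-label (Inverse.to (T c) x) (Inverse.to (T c) x′) (x≢x′ ∘ T-injective c))
      (cong₂ (λ i j → 𝟙 (cross? (toℕ i) (toℕ j))) (label-T c x) (label-T c x′))))
    (∑-rail-translate (label x) (label x′) (x≢x′ ∘ label-injective))
    where
    T-injective : ∀ c {x x′} → Inverse.to (T c) x ≡ Inverse.to (T c) x′ → x ≡ x′
    T-injective c {x} {x′} eq = trans (sym (Inverse.strictlyInverseʳ (T c) x))
      (trans (cong (Inverse.from (T c)) eq) (Inverse.strictlyInverseʳ (T c) x′))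

-- Combining factors inside pairs of cells with factors between cells

𝟙-≟W : ∀ {y h} σ (d d′ : Fin y) (s s′ : Fin h) →
  𝟙 ((σ , d , s) ≟W (σ , d′ , s′)) ≡ 𝟙 (d F.≟ d′) * 𝟙 (s F.≟ s′)
𝟙-≟W σ d d′ s s′ = trans
  (𝟙-cong ((σ , d , s) ≟W (σ , d′ , s′)) ((d F.≟ d′) ×-dec (s F.≟ s′))
    (λ { refl → refl , refl }) (λ { (refl , refl) → refl }))
  (𝟙-× (d F.≟ d′) (s F.≟ s′))

-- Edges exist only within one cycle `d`, where they are its rungs and rails; this separates the
-- choice of cells from the positions inside them.
edges-split : ∀ {y h} σ (d : Fin y) (s : Fin h) σ′ d′ s′ → edges (σ , d , s) (σ′ , d′ , s′) ≡
  𝟙 (d F.≟ d′) * (rung (σ , s) (σ′ , s′) + rail (σ , s) (σ′ , s′))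
edges-split false d s false d′ s′ = sym (*-zeroʳ (𝟙 (d F.≟ d′)))
edges-split false d s true  d′ s′ = trans (+-identityʳ _) (trans
  (cong₂ _+_ (𝟙-≟W false d d′ s s′) (𝟙-≟W false d d′ s (cycSuc s′)))
  (sym (*-distribˡ-+ (𝟙 (d F.≟ d′)) (𝟙 (s F.≟ s′)) (𝟙 (s F.≟ cycSuc s′)))))
edges-split true  d s false d′ s′ = trans
  (cong₂ _+_ (𝟙-≟W false d′ d s′ s) (𝟙-≟W false d′ d s′ (cycSuc s)))
  (trans (sym (*-distribˡ-+ (𝟙 (d′ F.≟ d)) (𝟙 (s′ F.≟ s)) (𝟙 (s′ F.≟ cycSuc s))))
    (cong₂ (λ p q → p * (q + 𝟙 (s′ F.≟ cycSuc s)))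
      (𝟙-cong (d′ F.≟ d) (d F.≟ d′) sym sym) (𝟙-cong (s′ F.≟ s) (s F.≟ s′) sym sym)))
edges-split true  d s true  d′ s′ = sym (*-zeroʳ (𝟙 (d F.≟ d′)))

-- Off by one: each factor has y + 1 cycles, of length 2(h + 1).
module TwoFold {y h : ℕ} (Gy : OddCyclicGroup y) (Gh : OddCyclicGroup h) (H : CyclicGroup h) where
  module Zy = Zigzag Gy
  module Zh = Zigzag Gh
  open CyclicGroup H
  open Inverse using (to; from; strictlyInverseˡ; strictlyInverseʳ)

  -- Each pair of cells {(σ, d, _)} σ = false, true carries the zigzag Hamiltonian cycle of K₂ₕ translated by c.
  hamiltonian : Fin (suc (h + h)) → W (suc y) (suc h) ↔ W (suc y) (suc h)
  hamiltonian c = mk↔ₛ′ (along (to (Zh.T c))) (along (from (Zh.T c)))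
    (λ (σ , d , s) → cong (insert d) (strictlyInverseˡ (Zh.T c) (σ , s)))
    (λ (σ , d , s) → cong (insert d) (strictlyInverseʳ (Zh.T c) (σ , s)))
    where
    insert : Fin (suc y) → Bool × Fin (suc h) → W (suc y) (suc h)
    insert d (σ , s) = σ , d , s
    along : (Bool × Fin (suc h) → Bool × Fin (suc h)) → W (suc y) (suc h) → W (suc y) (suc h)
    along f (σ , d , s) = insert d (f (σ , s))

  shift unshift : Fin (suc h) → Bool → Fin (suc h) → Fin (suc h)
  shift t false s   = s
  shift t true  s   = s ⊝ t
  unshift t false s = s
  unshift t true  s = s ⊕ t

  -- The 1-factor of K₂ᵧ with index c pairs the cells, and each K_{h,h}(2) between
  -- paired cells splits into the Hamiltonian cycles with differences t and t − 1.
  bipartite : Fin (suc (y + y)) → Fin (suc h) → W (suc y) (suc h) ↔ W (suc y) (suc h)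
  bipartite c t = mk↔ₛ′
    (λ (σ , d , s) → let σ′ , d′ = to (Zy.T c) (σ , d) in σ′ , d′ , shift t σ′ s)
    (λ (σ , d , s) → let σ′ , d′ = from (Zy.T c) (σ , d) in σ′ , d′ , unshift t σ s)
    (λ (σ , d , s) → trans (cong (λ (σ′ , d′) → σ′ , d′ , shift t σ′ (unshift t σ s)) (strictlyInverseˡ (Zy.T c) (σ , d)))
      (cong (λ s → σ , d , s) (shift-unshift σ s)))
    (λ (σ , d , s) → let σ′ = proj₁ (to (Zy.T c) (σ , d)) in
      cong₂ (λ (σ , d) s → σ , d , s) (strictlyInverseʳ (Zy.T c) (σ , d)) (unshift-shift σ′ s))
    where
    shift-unshift : ∀ σ s → shift t σ (unshift t σ s) ≡ s
    shift-unshift false s = refl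
    shift-unshift true  s = ⊕-⊝ s t
    unshift-shift : ∀ σ s → unshift t σ (shift t σ s) ≡ s
    unshift-shift false s = refl
    unshift-shift true  s = ⊝-⊕ s t

  ∑-⊝ : ∀ s s′ → ∑ (λ t → 𝟙 (s F.≟ s′ ⊝ t)) ≡ 1
  ∑-⊝ s s′ = ∑-unique (λ t → s F.≟ s′ ⊝ t) (s′ ⊝ s)
    (λ { {t} refl → sym (⊝-involutive s′ t) }) (sym (⊝-involutive s′ s))

  ∑-cycSuc-⊝ : ∀ s s′ → ∑ (λ t → 𝟙 (s F.≟ cycSuc (s′ ⊝ t))) ≡ 1
  ∑-cycSuc-⊝ s s′ = trans
    (sum-cong-≗ (λ t → 𝟙-cong (s F.≟ cycSuc (s′ ⊝ t)) (s ⊝ one F.≟ s′ ⊝ t)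
      (λ eq → sym (⊕⇒⊝ (sym (trans eq (cycSuc≡⊕one (s′ ⊝ t))))))
      (λ eq → trans (⊝⇒⊕ eq) (sym (cycSuc≡⊕one (s′ ⊝ t))))))
    (∑-⊝ (s ⊝ one) s′)

  -- As `t` runs through all residues, two points in paired cells form a rung for one `t` and a rail
  -- for one `t`. This gives the factor 2.
  ∑-bipartite : ∀ σ (d : Fin (suc y)) s σ′ d′ s′ →
    ∑ (λ t → edges (σ , d , shift t σ s) (σ′ , d′ , shift t σ′ s′)) ≡ 2 * rung (σ , d) (σ′ , d′)
  ∑-bipartite σ d s σ′ d′ s′ = trans
    (sum-cong-≗ (λ t → edges-split σ d (shift t σ s) σ′ d′ (shift t σ′ s′)))
    (trans (sym (*-distribˡ-sum (𝟙 (d F.≟ d′)) cyc))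
    (trans (cong (𝟙 (d F.≟ d′) *_) (∑-distrib-+
      (λ t → rung (σ , shift t σ s) (σ′ , shift t σ′ s′)) (λ t → rail (σ , shift t σ s) (σ′ , shift t σ′ s′))))
    (cases σ σ′)))
    where
    cyc : Fin (suc h) → ℕ
    cyc t = rung (σ , shift t σ s) (σ′ , shift t σ′ s′) + rail (σ , shift t σ s) (σ′ , shift t σ′ s′)
    cases : ∀ σ σ′ → 𝟙 (d F.≟ d′) *
      (∑ (λ t → rung (σ , shift t σ s) (σ′ , shift t σ′ s′)) + ∑ (λ t → rail (σ , shift t σ s) (σ′ , shift t σ′ s′)))
      ≡ 2 * rung (σ , d) (σ′ , d′)
    none : 𝟙 (d F.≟ d′) * (∑ {suc h} (λ _ → 0) + ∑ {suc h} (λ _ → 0)) ≡ 0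
    none = trans (cong (𝟙 (d F.≟ d′) *_) (cong₂ _+_ (∑-zero {suc h} (λ _ → 0) (λ _ → refl)) (∑-zero {suc h} (λ _ → 0) (λ _ → refl))))
      (*-zeroʳ (𝟙 (d F.≟ d′)))
    cases false false = none
    cases true  true  = none
    cases false true  = trans (cong (𝟙 (d F.≟ d′) *_) (cong₂ _+_ (∑-⊝ s s′) (∑-cycSuc-⊝ s s′)))
      (*-comm (𝟙 (d F.≟ d′)) 2)
    cases true  false = trans (cong (𝟙 (d F.≟ d′) *_) (cong₂ _+_
      (trans (sum-cong-≗ (λ t → 𝟙-cong (s ⊝ t F.≟ s′) (s′ F.≟ s ⊝ t) sym sym)) (∑-⊝ s′ s)) (∑-cycSuc-⊝ s′ s)))
      (*-comm (𝟙 (d F.≟ d′)) 2)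

  ∑-hamiltonian : ∀ {w w′} → w ≢ w′ →
    ∑ (λ c → edges (to (hamiltonian c) w) (to (hamiltonian c) w′)) ≡ 2 * 𝟙 (proj₁ (proj₂ w) F.≟ proj₁ (proj₂ w′))
  ∑-hamiltonian {σ , d , s} {σ′ , d′ , s′} w≢w′ = begin
    ∑ (λ c → edges (to (hamiltonian c) (σ , d , s)) (to (hamiltonian c) (σ′ , d′ , s′)))
      ≡⟨ sum-cong-≗ (λ c → let σ₁ , s₁ = to (Zh.T c) (σ , s) ; σ₂ , s₂ = to (Zh.T c) (σ′ , s′) in
           edges-split σ₁ d s₁ σ₂ d′ s₂) ⟩
    ∑ (λ c → 𝟙 (d F.≟ d′) * (rungs c + rails c))
      ≡⟨ sym (*-distribˡ-sum (𝟙 (d F.≟ d′)) (λ c → rungs c + rails c)) ⟩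
    𝟙 (d F.≟ d′) * ∑ (λ c → rungs c + rails c)
      ≡⟨ 𝟙-absorb (d F.≟ d′) (λ { refl → trans (∑-distrib-+ rungs rails)
           (cong₂ _+_ (Zh.∑-rung (σ , s) (σ′ , s′) (λ { refl → w≢w′ refl })) (Zh.∑-rail (σ , s) (σ′ , s′) (λ { refl → w≢w′ refl }))) }) ⟩
    𝟙 (d F.≟ d′) * 2
      ≡⟨ *-comm (𝟙 (d F.≟ d′)) 2 ⟩
    2 * 𝟙 (d F.≟ d′) ∎
    where
    open ≡-Reasoning
    rungs rails : Fin (suc (h + h)) → ℕ
    rungs c = rung (to (Zh.T c) (σ , s)) (to (Zh.T c) (σ′ , s′))
    rails c = rail (to (Zh.T c) (σ , s)) (to (Zh.T c) (σ′ , s′))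

  -- The translation by `zero` is omitted: its rungs pair `(false , d)` with `(true , d)`, and those
  -- pairs of cells carry the zigzag cycles.
  otherRungs : Bool × Fin (suc y) → Bool × Fin (suc y) → ℕ
  otherRungs x x′ = ∑ (λ c → rung (to (Zy.T (suc c)) x) (to (Zy.T (suc c)) x′))

  rung+otherRungs : ∀ x x′ → x ≢ x′ → rung x x′ + otherRungs x x′ ≡ 1
  rung+otherRungs x x′ x≢x′ = trans
    (cong (_+ otherRungs x x′) (cong₂ rung (sym (Zy.T-zero x)) (sym (Zy.T-zero x′)))) (Zy.∑-rung x x′ x≢x′)

  -- For distinct cells, equality of `d` and `d′` is equivalent to being a rung of the omitted
  -- 1-factor, and `∑-rung` applies. For a single cell the first term is 1 and no rung joins the
  -- cell to itself.
  same+otherRungs : ∀ σ d σ′ d′ → 𝟙 (d F.≟ d′) + otherRungs (σ , d) (σ′ , d′) ≡ 1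
  same+otherRungs σ d σ′ d′ with d F.≟ d′
  same+otherRungs σ d σ′ d′ | no d≢d′ =
    trans (cong (_+ otherRungs (σ , d) (σ′ , d′)) (sym (rung-≢ σ σ′))) (rung+otherRungs (σ , d) (σ′ , d′) (d≢d′ ∘ ,-injectiveʳ))
    where
    rung-≢ : ∀ σ σ′ → rung (σ , d) (σ′ , d′) ≡ 0
    rung-≢ false false = refl
    rung-≢ false true  = 𝟙-no (d F.≟ d′) d≢d′
    rung-≢ true  false = 𝟙-no (d F.≟ d′) d≢d′
    rung-≢ true  true  = refl
  same+otherRungs σ d σ′ .d | yes refl with σ Bool.≟ σ′
  ... | yes refl = cong suc (∑-zero _ (λ c → rung-irrefl (to (Zy.T (suc c)) (σ , d))))
  ... | no σ≢σ′  = trans (cong (_+ otherRungs (σ , d) (σ′ , d)) (sym (rung-≡ σ σ′ σ≢σ′)))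
      (rung+otherRungs (σ , d) (σ′ , d) (σ≢σ′ ∘ ,-injectiveˡ))
    where
    rung-≡ : ∀ σ σ′ → σ ≢ σ′ → rung (σ , d) (σ′ , d) ≡ 1
    rung-≡ false false σ≢σ′ = ⊥-elim (σ≢σ′ refl)
    rung-≡ false true  _    = 𝟙-yes (d F.≟ d) refl
    rung-≡ true  false _    = 𝟙-yes (d F.≟ d) refl
    rung-≡ true  true  σ≢σ′ = ⊥-elim (σ≢σ′ refl)

  factorization : ∀ {g} → Fin g ↔ W (suc y) (suc h) → TwoFoldFactorization (suc y) (suc h) g
  factorization {g} ι = record
    { labellings = map hams (allFin (suc (h + h))) ++ concatMap bips (allFin (y + y))
    ; twice      = λ {a} {b} a≢b → total a b (λ eq → a≢b
        (trans (sym (strictlyInverseʳ ι a)) (trans (cong (from ι) eq) (strictlyInverseʳ ι b))))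
    }
    where
    hams : Fin (suc (h + h)) → Fin g ↔ W (suc y) (suc h)
    hams c = ↔-trans ι (hamiltonian c)
    bip : Fin (y + y) → Fin (suc h) → Fin g ↔ W (suc y) (suc h)
    bip c t = ↔-trans ι (bipartite (suc c) t)
    bips : Fin (y + y) → List (Fin g ↔ W (suc y) (suc h))
    bips c = map (bip c) (allFin (suc h))
    total : ∀ a b → to ι a ≢ to ι b → sumL (λ L → edges (to L a) (to L b))
      (map hams (allFin (suc (h + h))) ++ concatMap bips (allFin (y + y))) ≡ 2
    total a b w≢w′ = begin
      sumL E (map hams (allFin (suc (h + h))) ++ concatMap bips (allFin (y + y)))
        ≡⟨ sumL-++ E (map hams (allFin (suc (h + h)))) (concatMap bips (allFin (y + y))) ⟩
      sumL E (map hams (allFin (suc (h + h)))) + sumL E (concatMap bips (allFin (y + y)))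
        ≡⟨ cong₂ _+_ (sumL-map-allFin E hams) (sumL-concatMap-allFin E bips) ⟩
      ∑ (E ∘ hams) + ∑ (λ c → sumL E (bips c))
        ≡⟨ cong₂ _+_ (∑-hamiltonian w≢w′) (sum-cong-≗ sum-bips) ⟩
      2 * 𝟙 (d F.≟ d′) + ∑ (λ c → 2 * rungs c)
        ≡⟨ cong (2 * 𝟙 (d F.≟ d′) +_) (*-distribˡ-sum 2 rungs) ⟨
      2 * 𝟙 (d F.≟ d′) + 2 * ∑ rungs
        ≡⟨ *-distribˡ-+ 2 (𝟙 (d F.≟ d′)) (∑ rungs) ⟨
      2 * (𝟙 (d F.≟ d′) + ∑ rungs)
        ≡⟨ cong (2 *_) (same+otherRungs σ d σ′ d′) ⟩
      2 ∎
      where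
      open ≡-Reasoning
      E : Fin g ↔ W (suc y) (suc h) → ℕ
      E L = edges (to L a) (to L b)
      σ = proj₁ (to ι a)
      d = proj₁ (proj₂ (to ι a))
      s = proj₂ (proj₂ (to ι a))
      σ′ = proj₁ (to ι b)
      d′ = proj₁ (proj₂ (to ι b))
      s′ = proj₂ (proj₂ (to ι b))
      rungs : Fin (y + y) → ℕ
      rungs c = rung (to (Zy.T (suc c)) (σ , d)) (to (Zy.T (suc c)) (σ′ , d′))
      sum-bips : ∀ c → sumL E (bips c) ≡ 2 * rungs c
      sum-bips c = trans (sumL-map-allFin E (bip c))
        (let σ₁ , d₁ = to (Zy.T (suc c)) (σ , d) ; σ₂ , d₂ = to (Zy.T (suc c)) (σ′ , d′) in
         ∑-bipartite σ₁ d₁ s σ₂ d₂ s′)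

-- The initial labelling and the choice of parameters

vertices↔W : ∀ y h → Fin (h * 2 * y) ↔ W y h
vertices↔W y h = ↔-trans *↔× (mk↔ₛ′
  (λ (t , d) → let s , σ = unpos h t in σ , d , s)
  (λ (σ , d , s) → pos s σ , d)
  (λ (σ , d , s) → cong (λ (s , σ) → σ , d , s) (unpos-pos s σ))
  (λ (t , d) → cong (_, d) (pos-unpos h t)))

theorem4p5 : ∀ (k x y : ℕ) → 6 < k → 2 ∣ k → 2 ≤ y → 1 ≤ x → x ≢ 2 →
    ARCS k (4 * x) (k * y) 2
theorem4p5 _ zero _ _ _ _ () _
theorem4p5 _ _ zero _ _ () _ _
theorem4p5 _ _ _ () (divides zero refl) _ _ _
theorem4p5 _ (suc x) (suc y) _ (divides (suc h) refl) _ _ _ =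
  subst (λ u → ARCS (suc h * 2) u (suc h * 2 * suc y) 2) (order x)
    (Assembly.assemble
      -- With `suc x` for the given number, the modulus is 2(2x + 1) + 1 = 4x + 3; adding ∞ gives
      -- the order 4(x + 1).
      (Prolongation.idempotentQuasigroup (oddCyclicGroup (suc (x + x))))
      (TwoFold.factorization (oddCyclicGroup y) (oddCyclicGroup h) (Modular.cyclicGroup h)
        (vertices↔W (suc y) (suc h))))
  where
  order : ∀ x → suc (suc (suc (x + x) + suc (x + x))) ≡ 4 * suc x
  order = solve-∀
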